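{- Let $d\ge1$, $k\ge2$, $h\ge2$, $r\ge kh$ be integers. For all sufficiently large $n$ and every subset $A\subseteq[n]^d$ with $|A|\ge\frac{n^d}{\log n}$, there exists a collection $\mathcal{C}$ of $r$-templates of $A$ such that (i) every $r$-template of $A$ without rainbow solutions to the $B_{k,h}$-equation is a subtemplate of some $P\in\mathcal{C}$; (ii) for every $P\in\mathcal{C}$, $R(P)\le\frac{1}{(\log n)^{5kh}}|A|^{k(h-1)+1}$; (iii) $|\mathcal{C}|\le 2^{|A|\,n^{ -\frac{k(h-1)}{kh-1}d}(\log n)^{10}}$.
   Context: $[n]^d$ is the set of vectors in $\mathbb{Z}^d$ with coordinates in $\{1,\dots,n\}$, with coordinatewise addition. The $B_{k,h}$-equation is $\sum_{i=1}^h x_{1,i}=\cdots=\sum_{i=1}^h x_{k,i}$ in points $x_{\ell,i}$, $\ell\in[k],i\in[h]$. An $r$-template of $A$ is a function $P:A\to 2^{[r]}$ (each $P(x)\subseteq[r]$ is the palette at $x$). $P_1$ is a subtemplate of $P_2$ if $P_1(x)\subseteq P_2(x)$ for all $x\in A$. An $r$-template $P$ is a rainbow solution to the $B_{k,h}$-equation if there are $kh$ points $x_{\ell,i}\in A$ satisfying the $B_{k,h}$-equation with $|P(x_{\ell,i})|=1$ for all $\ell,i$, $P(x)=\emptyset$ for all other $x\in A$, and the palettes $P(x_{\ell,i})$ pairwise distinct. A template contains no rainbow solutions if it has no subtemplate that is a rainbow solution. $R(P)$ is the number of subtemplates of $P$ that are rainbow solutions. Logarithms are base 2. -}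

module Defs where

open import Data.Nat using (ℕ; zero; suc; _+_; _*_; _^_; _≤_; _<_)
open import Data.Fin using (Fin)
import Data.Fin as F
open import Data.Fin.Subset using (Subset; ⊥; ∣_∣; _⊆_)
open import Data.Vec using (Vec; lookup; zipWith; replicate)
open import Data.Vec.Relation.Unary.All using (All)
import Data.List.Relation.Unary.All
open import Data.List using (List; length)
import Data.List as L
open import Data.List.Relation.Unary.Unique.Propositional using (Unique)
open import Data.Product using (_×_; Σ; ∃; _,_)
open import Relation.Binary.PropositionalEquality using (_≡_; _≢_)
open import Relation.Nullary using (¬_)

-- Points of ℤ^d (all relevant points have positive coordinates, so ℕ^d)

Point : ℕ → Set
Point d = Vec ℕ d

_⊕_ : ∀ {d} → Point d → Point d → Point d
_⊕_ = zipWith _+_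

sumPts : ∀ {d} h → (Fin h → Point d) → Point d
sumPts {d} zero    f = replicate d 0
sumPts     (suc h) f = f F.zero ⊕ sumPts h (λ i → f (F.suc i))

InBox : ℕ → ∀ {d} → Point d → Set
InBox n = All (λ c → 1 ≤ c × c ≤ n)

record SubsetOfBox (n d : ℕ) : Set where
  field
    pts    : List (Point d)
    inBox  : Data.List.Relation.Unary.All.All (InBox n) pts
    unique : Unique pts
  size : ℕ
  size = length pts
  point : Fin size → Point d
  point = L.lookup pts
open SubsetOfBox public

-- r-templates of A: a palette P(x) ⊆ [r] for every x ∈ A
-- (indexed by the position of x in the list of A)

Template : ∀ {n d} → ℕ → SubsetOfBox n d → Set
Template r A = Vec (Subset r) (size A)

palette : ∀ {n d r} {A : SubsetOfBox n d} → Template r A → Fin (size A) → Subset r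
palette P x = lookup P x

Subtemplate : ∀ {n d r} {A : SubsetOfBox n d} → Template r A → Template r A → Set
Subtemplate {A = A} P₁ P₂ = ∀ (x : Fin (size A)) → palette {A = A} P₁ x ⊆ palette {A = A} P₂ x

RainbowSolution : ∀ {n d r} (k h : ℕ) {A : SubsetOfBox n d} → Template r A → Set
RainbowSolution k h {A = A} P =
  Σ (Fin k → Fin h → Fin (size A)) λ x →
      (∀ ℓ ℓ' → sumPts h (λ i → point A (x ℓ i)) ≡ sumPts h (λ i → point A (x ℓ' i)))
    × (∀ ℓ i → ∣ palette {A = A} P (x ℓ i) ∣ ≡ 1)
    × (∀ y → (∀ ℓ i → y ≢ x ℓ i) → palette {A = A} P y ≡ ⊥)
    × (∀ ℓ i ℓ' i' → ¬ (ℓ ≡ ℓ' × i ≡ i') → palette {A = A} P (x ℓ i) ≢ palette {A = A} P (x ℓ' i'))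

NoRainbow : ∀ {n d r} (k h : ℕ) {A : SubsetOfBox n d} → Template r A → Set
NoRainbow k h {A = A} P = ∀ (Q : Template _ A) → Subtemplate {A = A} Q P → ¬ RainbowSolution k h {A = A} Q

-- R(P) ≤ m  is expressed as: every duplicate-free list of subtemplates of P
-- that are rainbow solutions has length ≤ m.  Here we give the predicate
-- "Rs is a list of distinct rainbow subtemplates of P".
RainbowSubtemplates : ∀ {n d r} (k h : ℕ) {A : SubsetOfBox n d} →
                      Template r A → List (Template r A) → Set
RainbowSubtemplates k h {A = A} P Rs =
  Unique Rs × Data.List.Relation.Unary.All.All
                (λ Q → Subtemplate {A = A} Q P × RainbowSolution k h {A = A} Q) Rs

-- Exact ℕ-encodings of the real inequalities involving log₂ n.
-- For q ≥ 1 and n ≥ 1:  p/q < log₂ n  ⇔  2^p < n^q,   p/q > log₂ n  ⇔  n^q < 2^p.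

-- a ≥ n^d / log₂ n   (⇔ a·log₂ n ≥ n^d ⇔ n^a ≥ 2^(n^d))
LargeSet : (n d a : ℕ) → Set
LargeSet n d a = 2 ^ (n ^ d) ≤ n ^ a

-- R ≤ M / (log₂ n)^K, i.e. R·(log₂ n)^K ≤ M, encoded as:
-- for every rational p/q < log₂ n,  R·(p/q)^K ≤ M.
BoundByLogPow : (n K M R : ℕ) → Set
BoundByLogPow n K M R =
  ∀ p q → 1 ≤ q → 2 ^ p < n ^ q → R * p ^ K ≤ M * q ^ K

-- c ≤ 2^( a · n^(-e/b) · (log₂ n)^10 )  (b ≥ 1), encoded as:
-- for every rational s = p/q < log₂ c (i.e. 2^p < c^q) and every rational
-- u = p'/q' > log₂ n (i.e. n^q' < 2^p'), we have s^b · n^e ≤ a^b · u^(10b),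
-- which (by density/continuity) is equivalent to log₂ c ≤ a·n^(-e/b)·(log₂ n)^10.
CountBound : (n a e b c : ℕ) → Set
CountBound n a e b c =
  ∀ p q p' q' → 1 ≤ q → 1 ≤ q' → 2 ^ p < c ^ q → n ^ q' < 2 ^ p' →
    p ^ b * n ^ e * q' ^ (10 * b) ≤ a ^ b * q ^ b * p' ^ (10 * b)

{-# OPTIONS --safe #-}
module Submission where

-- Rainbow solutions are the edges of an s-uniform hypergraph (s = kh) on the vertex set A × [r], and
-- templates without rainbow solutions are its independent sets, so the claim is a container theorem.
-- Edges are kept as ordered s-tuples.  In one container step the vertices are scanned for the membership
-- in the independent set I; the links (head removed) of the vertices of I are collected into a hypergraph
-- of smaller uniformity, leaving out tuples that contain a partial tuple whose degree is saturated.  Either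
-- the collection becomes large after few "yes" answers and one recurses on it, or the vertices that are not
-- excluded carry few edges.  A step with at most (N+1)^(O(N/b)) outcomes removes a constant proportion of the
-- edges, as long as b^(m-1) N Δ_m is at most a constant times the number of edges for 2 ≤ m ≤ s.
-- If m fixed vertices fill up q rows, they extend to at most about |A|^(s-k-m+max(q,1)) solutions, so b may be
-- taken just below |A|^(k(h-1)/(kh-1)) up to logarithms (only m = s is tight), and O(log n) steps suffice.

-- No control of single vertex degrees is available, since the induced subhypergraphs met in the
-- iteration are irregular. So the capacity of one vertex is not a constant: it is its own degree in
-- the hypergraph at that coordinate, plus a small term. If a container leaves out vertices carrying
-- many tuples of a derived hypergraph, these can be charged to edges of the original one through
-- the same vertices. Only patterns of two or more vertices need a hypothesis, and it is demanded
-- only while the edge count exceeds the target of (ii). All quantities are natural numbers: weights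
-- `κ` and `ρ` clear divisions, inequalities with real exponents are raised to the power kh - 1, and
-- log n is enclosed by `ℓ` and `Λ` = ℓ + 1. The 10 in (iii): one power of log n comes from the
-- number of steps and one from the cost of naming a vertex; |A| ≥ n^d / log n costs less than one,
-- and the 5kh powers allowed in (ii) cost 5kh / (kh - 1) through b. As kh ≥ 4, the total is below
-- 10 and the surplus absorbs the constants.

open import Defs
open import Data.Bool using (Bool; true; false; T; _∧_; _∨_)
open import Data.Bool.Properties using (T?; T-∧; T-≡)
open import Data.Fin using (Fin; zero; suc)
import Data.Fin.Properties as Fin
open import Data.Fin.Subset using (Subset; ⊥; ⁅_⁆; ∣_∣) renaming (_∈_ to _∈ˢ_)
open import Data.Fin.Subset.Properties using (x∈⁅x⁆; x∈⁅y⁆⇒x≡y; ∣⁅x⁆∣≡1; ∉⊥)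
open import Data.List using (List; []; _∷_; _++_; length; map; filter; applyUpTo; allFin; cartesianProductWith; cartesianProduct) renaming (lookup to lookupᴸ)
open import Data.List.Membership.Propositional using (_∈_; find)
open import Data.List.Membership.Propositional.Properties using (∈-filter⁻; ∈-filter⁺; ∈-map⁺; ∈-map⁻; ∈-∃++; ∈-lookup; ∈-allFin; ∈-applyUpTo⁺; ∈-cartesianProductWith⁺; ∈-cartesianProduct⁺)
open import Data.List.Properties using (length-++; length-map; length-tabulate; length-applyUpTo)
open import Data.List.Relation.Unary.All as All using (All; []; _∷_)
open import Data.List.Relation.Unary.AllPairs using ([]; _∷_)
open import Data.List.Relation.Unary.Any as Any using (Any; here; there; any?)
open import Data.List.Relation.Unary.Any.Properties using (++⁺ˡ; ++⁺ʳ; ++⁻)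
open import Data.List.Relation.Unary.Unique.Propositional using (Unique)
open import Data.List.Relation.Unary.Unique.Propositional.Properties using (allFin⁺; cartesianProduct⁺)
open import Data.Maybe using (Maybe; just; nothing)
open import Data.Nat hiding (_≟_)
open import Data.Nat.DivMod using (m≡m%n+[m/n]*n; m%n<n; m/n*n≤m)
open import Data.Nat.Properties hiding (_≟_)
open import Data.Nat.Tactic.RingSolver using (solve-∀)
open import Data.Product using (Σ; ∃; ∃₂; _×_; _,_; proj₁; proj₂)
open import Data.Product.Properties using (≡-dec)
open import Data.Sum using (_⊎_; inj₁; inj₂; [_,_]′; map₁)
open import Data.Unit using (⊤; tt)
open import Data.Vec as Vec using (Vec; []; _∷_; head; tail; lookup; tabulate; replicate; concat)
open import Data.Vec.Properties using (∷-injective; ++-injective; tabulate-∘; tabulate-cong; tabulate∘lookup; lookup∘tabulate; lookup⇒[]=; []=⇒lookup) renaming (≡-dec to vec-≟)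
open import Data.Vec.Relation.Unary.All as VecAll using ([]; _∷_)
open import Data.Vec.Relation.Unary.All.Properties using (lookup⁺; lookup⁻; concat⁺; concat⁻)
open import Function using (_∘_; id; Equivalence)
open import Level using (0ℓ)
open import Relation.Binary.Definitions using (DecidableEquality)
open import Relation.Binary.PropositionalEquality using (_≡_; _≢_; refl; sym; trans; cong; cong₂; subst; module ≡-Reasoning)
open import Relation.Nullary using (¬_; Dec; yes; no; contradiction; ¬?; _×-dec_; _→-dec_; does)
open import Relation.Nullary.Decidable using (map′)
open import Relation.Unary using (Pred; Decidable)

-- Counting in lists

private variable
  A B U : Set
  P Q R : Pred A 0ℓ

sumOver : (A → ℕ) → List A → ℕ
sumOver f []       = 0
sumOver f (x ∷ xs) = f x + sumOver f xs

sumOver-mono-≤ : {f g : A → ℕ} → (∀ x → f x ≤ g x) → ∀ xs → sumOver f xs ≤ sumOver g xs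
sumOver-mono-≤ f≤g []       = z≤n
sumOver-mono-≤ f≤g (x ∷ xs) = +-mono-≤ (f≤g x) (sumOver-mono-≤ f≤g xs)

sumOver-const : ∀ c (xs : List A) → sumOver (λ _ → c) xs ≡ length xs * c
sumOver-const c []       = refl
sumOver-const c (x ∷ xs) = cong (c +_) (sumOver-const c xs)

sumOver-+ : ∀ (f g : A → ℕ) xs → sumOver (λ x → f x + g x) xs ≡ sumOver f xs + sumOver g xs
sumOver-+ f g []       = refl
sumOver-+ f g (x ∷ xs) rewrite sumOver-+ f g xs = interchange (f x) (g x) (sumOver f xs) (sumOver g xs)
  where
  interchange : ∀ a b c d → a + b + (c + d) ≡ a + c + (b + d)
  interchange = solve-∀

sumOver-*ˡ : ∀ c (f : A → ℕ) xs → sumOver (λ x → c * f x) xs ≡ c * sumOver f xs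
sumOver-*ˡ c f []       = sym (*-zeroʳ c)
sumOver-*ˡ c f (x ∷ xs) rewrite sumOver-*ˡ c f xs = sym (*-distribˡ-+ c (f x) (sumOver f xs))

sumOver-swap : ∀ (f : A → B → ℕ) xs ys →
               sumOver (λ x → sumOver (f x) ys) xs ≡ sumOver (λ y → sumOver (λ x → f x y) xs) ys
sumOver-swap f []       ys = sym (trans (sumOver-const 0 ys) (*-zeroʳ (length ys)))
sumOver-swap f (x ∷ xs) ys =
  trans (cong (sumOver (f x) ys +_) (sumOver-swap f xs ys))
        (sym (sumOver-+ (f x) (λ y → sumOver (λ x′ → f x′ y) xs) ys))

sumOver-++ : ∀ (f : A → ℕ) xs ys → sumOver f (xs ++ ys) ≡ sumOver f xs + sumOver f ys
sumOver-++ f []       ys = refl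
sumOver-++ f (x ∷ xs) ys rewrite sumOver-++ f xs ys = sym (+-assoc (f x) (sumOver f xs) (sumOver f ys))

sumOver-map : ∀ (f : B → ℕ) (g : A → B) xs → sumOver f (map g xs) ≡ sumOver (f ∘ g) xs
sumOver-map f g []       = refl
sumOver-map f g (x ∷ xs) = cong (f (g x) +_) (sumOver-map f g xs)

sumOver-product : ∀ (f : U → ℕ) (c : A → B → U) xs ys →
                  sumOver f (cartesianProductWith c xs ys) ≡ sumOver (λ x → sumOver (f ∘ c x) ys) xs
sumOver-product f c []       ys = refl
sumOver-product f c (x ∷ xs) ys =
  trans (sumOver-++ f (map (c x) ys) (cartesianProductWith c xs ys))
        (cong₂ _+_ (sumOver-map f (c x) ys) (sumOver-product f c xs ys))

indicator : {P : Set} → Dec P → ℕ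
indicator (yes _) = 1
indicator (no  _) = 0

indicator-mono-≤ : {P Q : Set} (P? : Dec P) (Q? : Dec Q) → (P → Q) → indicator P? ≤ indicator Q?
indicator-mono-≤ (no  _) _       _   = z≤n
indicator-mono-≤ (yes p) (yes q) _   = ≤-refl
indicator-mono-≤ (yes p) (no ¬q) imp = contradiction (imp p) ¬q

indicator≤1 : {P : Set} (P? : Dec P) → indicator P? ≤ 1
indicator≤1 (yes _) = ≤-refl
indicator≤1 (no  _) = z≤n

indicator-× : {P Q : Set} (P? : Dec P) (Q? : Dec Q) → indicator (P? ×-dec Q?) ≡ indicator P? * indicator Q?
indicator-× (yes _) (yes _) = refl
indicator-× (yes _) (no  _) = refl
indicator-× (no  _) _       = refl

count : {P : Pred A 0ℓ} → Decidable P → List A → ℕ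
count P? = sumOver (λ x → indicator (P? x))

count-mono-≤ : (P? : Decidable P) (Q? : Decidable Q) → (∀ x → P x → Q x) → ∀ xs → count P? xs ≤ count Q? xs
count-mono-≤ P? Q? imp = sumOver-mono-≤ (λ x → indicator-mono-≤ (P? x) (Q? x) (imp x))

count≤length : (P? : Decidable P) → ∀ xs → count P? xs ≤ length xs
count≤length P? []       = z≤n
count≤length P? (x ∷ xs) = +-mono-≤ (indicator≤1 (P? x)) (count≤length P? xs)

count-none : (P? : Decidable P) → (∀ x → ¬ P x) → ∀ xs → count P? xs ≡ 0
count-none P? none []       = refl
count-none P? none (x ∷ xs) with P? x
... | yes p = contradiction p (none x)
... | no  _ = count-none P? none xs

count-all : (P? : Decidable P) → ∀ xs → (∀ {x} → x ∈ xs → P x) → count P? xs ≡ length xs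
count-all P? []       all = refl
count-all P? (x ∷ xs) all with P? x
... | yes _ = cong suc (count-all P? xs (all ∘ there))
... | no ¬p = contradiction (all (here refl)) ¬p

count-cover : (P? : Decidable P) (Q? : Decidable Q) (R? : Decidable R) →
              (∀ x → P x → Q x ⊎ R x) → ∀ xs → count P? xs ≤ count Q? xs + count R? xs
count-cover P? Q? R? cover xs =
  ≤-trans (sumOver-mono-≤ pointwise xs)
          (≤-reflexive (sumOver-+ (λ x → indicator (Q? x)) (λ x → indicator (R? x)) xs))
  where
  pointwise : ∀ x → indicator (P? x) ≤ indicator (Q? x) + indicator (R? x)
  pointwise x with P? x
  ... | no _ = z≤n
  ... | yes p with cover x p
  ...   | inj₁ q = ≤-trans (indicator-mono-≤ (yes p) (Q? x) (λ _ → q)) (m≤m+n _ _)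
  ...   | inj₂ r = ≤-trans (indicator-mono-≤ (yes p) (R? x) (λ _ → r)) (m≤n+m _ _)

-- Union bound: where the disjunction holds some summand is 1, and the two summations are swapped.
count-Any : {F : B → Pred A 0ℓ} (F? : ∀ y → Decidable (F y)) (any? : ∀ ys x → Dec (Any (λ y → F y x) ys)) →
            ∀ ys xs → count (any? ys) xs ≤ sumOver (λ y → count (F? y) xs) ys
count-Any {F = F} F? any? ys xs =
  ≤-trans (sumOver-mono-≤ pointwise xs)
          (≤-reflexive (sumOver-swap (λ x y → indicator (F? y x)) xs ys))
  where
  positive : ∀ {x zs} → Any (λ y → F y x) zs → 1 ≤ sumOver (λ y → indicator (F? y x)) zs
  positive {x} {z ∷ zs} (here p)  = ≤-trans (indicator-mono-≤ (yes p) (F? z x) id) (m≤m+n _ _)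
  positive {x} {z ∷ zs} (there p) = ≤-trans (positive p) (m≤n+m _ _)
  pointwise : ∀ x → indicator (any? ys x) ≤ sumOver (λ y → indicator (F? y x)) ys
  pointwise x with any? ys x
  ... | yes p = positive p
  ... | no  _ = z≤n

length-filter : (P? : Decidable P) → ∀ xs → length (filter P? xs) ≡ count P? xs
length-filter P? []       = refl
length-filter P? (x ∷ xs) with P? x
... | yes _ = cong suc (length-filter P? xs)
... | no  _ = length-filter P? xs

count-filter-≤ : (Q? : Decidable Q) (P? : Decidable P) → ∀ xs → count Q? (filter P? xs) ≤ count Q? xs
count-filter-≤ Q? P? []       = z≤n
count-filter-≤ Q? P? (x ∷ xs) with P? x
... | yes _ = +-monoʳ-≤ (indicator (Q? x)) (count-filter-≤ Q? P? xs)
... | no  _ = ≤-trans (count-filter-≤ Q? P? xs) (m≤n+m _ _)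

count-map-filter : (f : A → B) (P? : Decidable P) (Q? : Decidable Q) (R? : Decidable R) →
                   (∀ x → P x → Q (f x) → R x) → ∀ xs → count Q? (map f (filter P? xs)) ≤ count R? xs
count-map-filter f P? Q? R? imp []       = z≤n
count-map-filter f P? Q? R? imp (x ∷ xs) with P? x
... | yes p = +-mono-≤ (indicator-mono-≤ (Q? (f x)) (R? x) (imp x p)) (count-map-filter f P? Q? R? imp xs)
... | no  _ = ≤-trans (count-map-filter f P? Q? R? imp xs) (m≤n+m _ _)

count-subsingleton : (P? : Decidable P) → (∀ {x y} → P x → P y → x ≡ y) → ∀ {xs} → Unique xs → count P? xs ≤ 1
count-subsingleton P? sub {[]}     []           = z≤n
count-subsingleton {P = P} P? sub {x ∷ xs} (x∉xs ∷ xs!) with P? x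
... | no  _ = count-subsingleton P? sub xs!
... | yes p = s≤s (≤-reflexive (none xs x∉xs))
  where
  none : ∀ ys → All (x ≢_) ys → count P? ys ≡ 0
  none []       []       = refl
  none (y ∷ ys) (x≢y ∷ x∉ys) with P? y
  ... | yes q = contradiction (sub p q) x≢y
  ... | no  _ = none ys x∉ys

module _ (_≟_ : DecidableEquality U) (f : A → U) (g : B → U) (α β w : ℕ)
         (xs : List A) (ys : List B) where

  -- The classes of us are split off one at a time, so that us may contain repetitions.
  count-classwise : ∀ us {P : Pred U 0ℓ} (P? : Decidable P) →
    (∀ {x} → x ∈ xs → P (f x) → f x ∈ us) →
    (∀ u → P u → α * count (λ x → f x ≟ u) xs ≤ β * count (λ y → g y ≟ u) ys + w) →
    α * count (λ x → P? (f x)) xs ≤ β * count (λ y → P? (g y)) ys + w * length us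
  count-classwise [] {P} P? inside _ = ≤-trans (≤-reflexive (trans (cong (α *_) (none xs inside)) (*-zeroʳ α))) z≤n
    where
    none : ∀ zs → (∀ {x} → x ∈ zs → P (f x) → f x ∈ []) → count (λ x → P? (f x)) zs ≡ 0
    none []       _ = refl
    none (z ∷ zs) h with P? (f z)
    ... | no  _ = none zs (h ∘ there)
    ... | yes p with () ← h (here refl) p
  count-classwise (u ∷ us) {P} P? inside classes with P? u
  ... | no ¬pu = ≤-trans
      (count-classwise us P?
        (λ x∈ p → Any.tail (λ eq → ¬pu (subst P eq p)) (inside x∈ p)) classes)
      (+-monoʳ-≤ (β * count (λ y → P? (g y)) ys) (*-monoʳ-≤ w (n≤1+n (length us))))
  ... | yes pu = begin
      α * count (λ x → P? (f x)) xs
        ≤⟨ *-monoʳ-≤ α (count-cover (λ x → P? (f x)) (λ x → P′? (f x)) (λ x → f x ≟ u) split xs) ⟩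
      α * (count (λ x → P′? (f x)) xs + count (λ x → f x ≟ u) xs)
        ≡⟨ *-distribˡ-+ α _ _ ⟩
      α * count (λ x → P′? (f x)) xs + α * count (λ x → f x ≟ u) xs
        ≤⟨ +-mono-≤ (count-classwise us P′? inside′ (λ v → classes v ∘ proj₁)) (classes u pu) ⟩
      β * count (λ y → P′? (g y)) ys + w * length us + (β * count (λ y → g y ≟ u) ys + w)
        ≡⟨ regroup β (count (λ y → P′? (g y)) ys) w (length us) (count (λ y → g y ≟ u) ys) ⟩
      β * (count (λ y → P′? (g y)) ys + count (λ y → g y ≟ u) ys) + w * suc (length us)
        ≤⟨ +-monoˡ-≤ (w * suc (length us)) (*-monoʳ-≤ β (disjoint ys)) ⟩
      β * count (λ y → P? (g y)) ys + w * suc (length us) ∎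
    where
    open ≤-Reasoning
    P′? : Decidable (λ v → P v × v ≢ u)
    P′? v = P? v ×-dec ¬? (v ≟ u)
    split : ∀ x → P (f x) → (P (f x) × f x ≢ u) ⊎ f x ≡ u
    split x p with f x ≟ u
    ... | yes eq = inj₂ eq
    ... | no  ne = inj₁ (p , ne)
    inside′ : ∀ {x} → x ∈ xs → P (f x) × f x ≢ u → f x ∈ us
    inside′ x∈ (p , ne) = Any.tail ne (inside x∈ p)
    regroup : ∀ β c w l c′ → β * c + w * l + (β * c′ + w) ≡ β * (c + c′) + w * suc l
    regroup = solve-∀
    pointwise : ∀ v → indicator (P′? v) + indicator (v ≟ u) ≤ indicator (P? v)
    pointwise v with v ≟ u | P? v
    ... | yes refl | yes _ = ≤-refl
    ... | yes refl | no ¬p = contradiction pu ¬p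
    ... | no _     | yes _ = ≤-refl
    ... | no _     | no  _ = z≤n
    disjoint : ∀ zs → count (λ y → P′? (g y)) zs + count (λ y → g y ≟ u) zs ≤ count (λ y → P? (g y)) zs
    disjoint zs = ≤-trans
      (≤-reflexive (sym (sumOver-+ (λ y → indicator (P′? (g y))) (λ y → indicator (g y ≟ u)) zs)))
      (sumOver-mono-≤ (λ y → pointwise (g y)) zs)

-- Pigeonhole: the partner of the first element is cut out of `ys`, and injectivity keeps the
-- partners of the other elements away from it. A relation suffices where partners are not unique.
length≤-by-relation : (R : A → B → Set) → (∀ {x x′ y} → R x y → R x′ y → x ≡ x′) →
  ∀ {xs} ys → Unique xs → (∀ {x} → x ∈ xs → ∃ λ y → y ∈ ys × R x y) → length xs ≤ length ys
length≤-by-relation R inj {[]}     ys _            image = z≤n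
length≤-by-relation {A = A} R inj {x ∷ xs} ys (x∉xs ∷ xs!) image
  with y , y∈ys , Rxy ← image (here refl)
  with ls , rs , refl ← ∈-∃++ y∈ys = ≤-trans
    (s≤s (length≤-by-relation R inj (ls ++ rs) xs! image′))
    (≤-reflexive (trans (cong suc (length-++ ls)) (sym (trans (length-++ ls) (+-suc (length ls) (length rs))))))
  where
  image′ : ∀ {x′} → x′ ∈ xs → ∃ λ y′ → y′ ∈ ls ++ rs × R x′ y′
  image′ x′∈xs with y′ , y′∈ , Rx′y′ ← image (there x′∈xs) with ++⁻ ls y′∈
  ... | inj₁ y′∈ls         = y′ , ++⁺ˡ y′∈ls , Rx′y′
  ... | inj₂ (there y′∈rs) = y′ , ++⁺ʳ ls y′∈rs , Rx′y′
  ... | inj₂ (here refl)   = contradiction (inj Rxy Rx′y′) (All.lookup x∉xs x′∈xs)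

count-disjoint : (P? : Decidable P) (Q? : Decidable Q) → (∀ x → P x → ¬ Q x) →
                 ∀ xs → count P? xs + count Q? xs ≤ length xs
count-disjoint P? Q? disjoint xs = ≤-trans
  (≤-reflexive (sym (sumOver-+ (λ x → indicator (P? x)) (λ x → indicator (Q? x)) xs)))
  (≤-trans (sumOver-mono-≤ pointwise xs) (≤-reflexive (trans (sumOver-const 1 xs) (*-identityʳ _))))
  where
  pointwise : ∀ x → indicator (P? x) + indicator (Q? x) ≤ 1
  pointwise x with P? x | Q? x
  ... | yes p | yes q = contradiction q (disjoint x p)
  ... | yes _ | no  _ = ≤-refl
  ... | no  _ | yes _ = ≤-refl
  ... | no  _ | no  _ = z≤n

count≤count-filter : (R? : Decidable R) (P? : Decidable P) (Q? : Decidable Q) →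
                     (∀ x → R x → P x × Q x) → ∀ xs → count R? xs ≤ count Q? (filter P? xs)
count≤count-filter R? P? Q? imp []       = z≤n
count≤count-filter R? P? Q? imp (x ∷ xs) with P? x
... | yes _ = +-mono-≤ (indicator-mono-≤ (R? x) (Q? x) (proj₂ ∘ imp x)) (count≤count-filter R? P? Q? imp xs)
... | no ¬p with R? x
...   | yes r = contradiction (proj₁ (imp x r)) ¬p
...   | no  _ = count≤count-filter R? P? Q? imp xs

indicator-≤-* : {P Q R : Set} (P? : Dec P) (Q? : Dec Q) (R? : Dec R) → (P → Q × R) →
                indicator P? ≤ indicator Q? * indicator R?
indicator-≤-* P? Q? R? imp =
  ≤-trans (indicator-mono-≤ P? (Q? ×-dec R?) imp) (≤-reflexive (indicator-× Q? R?))

sumOver-*ʳ : ∀ (f : A → ℕ) c xs → sumOver (λ x → f x * c) xs ≡ sumOver f xs * c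
sumOver-*ʳ f c []       = refl
sumOver-*ʳ f c (x ∷ xs) rewrite sumOver-*ʳ f c xs = sym (*-distribʳ-+ c (f x) (sumOver f xs))

count-product : {P : Pred A _} {Q : Pred B _} {R : Pred U _} (c : A → B → U)
  (P? : Decidable P) (Q? : Decidable Q) (R? : Decidable R) → (∀ x y → R (c x y) → P x × Q y) →
  ∀ xs ys → count R? (cartesianProductWith c xs ys) ≤ count P? xs * count Q? ys
count-product c P? Q? R? imp xs ys = begin
  count R? (cartesianProductWith c xs ys)
    ≡⟨ sumOver-product (λ z → indicator (R? z)) c xs ys ⟩
  sumOver (λ x → sumOver (λ y → indicator (R? (c x y))) ys) xs
    ≤⟨ sumOver-mono-≤ (λ x → ≤-trans
         (sumOver-mono-≤ (λ y → indicator-≤-* (R? (c x y)) (P? x) (Q? y) (imp x y)) ys)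
         (≤-reflexive (sumOver-*ˡ (indicator (P? x)) (λ y → indicator (Q? y)) ys))) xs ⟩
  sumOver (λ x → indicator (P? x) * count Q? ys) xs
    ≡⟨ sumOver-*ʳ (λ x → indicator (P? x)) (count Q? ys) xs ⟩
  count P? xs * count Q? ys ∎
  where open ≤-Reasoning

-- The order of summation is exchanged: once `y` is chosen, only the fibre over it remains for `x`.
count-fibre : {Q : Pred B _} {R : Pred U _} (c : A → B → U) {S : B → Pred A _}
  (Q? : Decidable Q) (R? : Decidable R) (S? : ∀ y → Decidable (S y)) →
  (∀ x y → R (c x y) → Q y × S y x) → ∀ xs ys m → (∀ y → count (S? y) xs ≤ m) →
  count R? (cartesianProductWith c xs ys) ≤ count Q? ys * m
count-fibre c Q? R? S? imp xs ys m fibre = begin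
  count R? (cartesianProductWith c xs ys)
    ≡⟨ sumOver-product (λ z → indicator (R? z)) c xs ys ⟩
  sumOver (λ x → sumOver (λ y → indicator (R? (c x y))) ys) xs
    ≡⟨ sumOver-swap (λ x y → indicator (R? (c x y))) xs ys ⟩
  sumOver (λ y → sumOver (λ x → indicator (R? (c x y))) xs) ys
    ≤⟨ sumOver-mono-≤ (λ y → ≤-trans
         (sumOver-mono-≤ (λ x → indicator-≤-* (R? (c x y)) (Q? y) (S? y x) (imp x y)) xs)
         (≤-trans (≤-reflexive (sumOver-*ˡ (indicator (Q? y)) (λ x → indicator (S? y x)) xs))
                  (*-monoʳ-≤ (indicator (Q? y)) (fibre y)))) ys ⟩
  sumOver (λ y → indicator (Q? y) * m) ys
    ≡⟨ sumOver-*ʳ (λ y → indicator (Q? y)) m ys ⟩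
  count Q? ys * m ∎
  where open ≤-Reasoning

-- One step of the container algorithm

-- A nonempty set of positions with prescribed entries; over `⊤` only the positions remain. `only`
-- marks the last prescribed position, so the empty pattern, whose degree would be the number of all
-- tuples, is excluded by construction.
data Pattern (A : Set) : ℕ → Set where
  only : ∀ {n} → A → Pattern A (suc n)
  skip : ∀ {n} → Pattern A n → Pattern A (suc n)
  also : ∀ {n} → A → Pattern A n → Pattern A (suc n)

width : ∀ {A n} → Pattern A n → ℕ
width (only _)   = 1
width (skip u)   = width u
width (also _ u) = suc (width u)

width≥1 : ∀ {A n} (u : Pattern A n) → 1 ≤ width u
width≥1 (only _)   = ≤-refl
width≥1 (skip u)   = width≥1 u
width≥1 (also _ u) = s≤s z≤n

width≤length : ∀ {A n} (u : Pattern A n) → width u ≤ n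
width≤length (only _)   = s≤s z≤n
width≤length (skip u)   = m≤n⇒m≤1+n (width≤length u)
width≤length (also _ u) = s≤s (width≤length u)

Mask : ℕ → Set
Mask = Pattern ⊤

restrict : ∀ {A n} → Mask n → Vec A n → Pattern A n
restrict (only _)   (x ∷ xs) = only x
restrict (skip S)   (x ∷ xs) = skip (restrict S xs)
restrict (also _ S) (x ∷ xs) = also x (restrict S xs)

also-injective : ∀ {A n} {x y : A} {u v : Pattern A n} → also x u ≡ also y v → x ≡ y × u ≡ v
also-injective refl = refl , refl

pattern-≟ : ∀ {A n} → DecidableEquality A → DecidableEquality (Pattern A n)
pattern-≟ _≟_ (only x)   (only y)   = map′ (cong only) (λ { refl → refl }) (x ≟ y)
pattern-≟ _≟_ (skip u)   (skip v)   = map′ (cong skip) (λ { refl → refl }) (pattern-≟ _≟_ u v)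
pattern-≟ _≟_ (also x u) (also y v) =
  map′ (λ (p , q) → cong₂ also p q) also-injective (x ≟ y ×-dec pattern-≟ _≟_ u v)
pattern-≟ _≟_ (only _)   (skip _)   = no λ ()
pattern-≟ _≟_ (only _)   (also _ _) = no λ ()
pattern-≟ _≟_ (skip _)   (only _)   = no λ ()
pattern-≟ _≟_ (skip _)   (also _ _) = no λ ()
pattern-≟ _≟_ (also _ _) (only _)   = no λ ()
pattern-≟ _≟_ (also _ _) (skip _)   = no λ ()

masks : ∀ n → List (Mask n)
masks zero    = []
masks (suc n) = only tt ∷ map skip (masks n) ++ map (also tt) (masks n)

∈-masks : ∀ {n} (S : Mask n) → S ∈ masks n
∈-masks (only tt)   = here refl
∈-masks (skip S)    = there (++⁺ˡ (∈-map⁺ skip (∈-masks S)))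
∈-masks (also tt S) = there (++⁺ʳ (map skip (masks _)) (∈-map⁺ (also tt) (∈-masks S)))

length-masks : ∀ n → suc (length (masks n)) ≡ 2 ^ n
length-masks zero    = refl
length-masks (suc n)
  rewrite length-++ (map skip (masks n)) {map (also tt) (masks n)}
        | length-map (skip {⊤}) (masks n) | length-map (also {⊤} tt) (masks n)
        | sym (length-masks n) = double (length (masks n))
  where
  double : ∀ m → suc (suc (m + m)) ≡ 2 * suc m
  double = solve-∀

insert : {V : Set} → DecidableEquality V → V → (V → Bool) → V → Bool
insert _≟_ w C x = does (x ≟ w) ∨ C x

module _ {V : Set} (_≟_ : DecidableEquality V) where

  insert⁻ : ∀ w C x → T (insert _≟_ w C x) → x ≡ w ⊎ T (C x)
  insert⁻ w C x t with x ≟ w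
  ... | yes eq = inj₁ eq
  ... | no  _  = inj₂ t

  insert-here : ∀ w C → T (insert _≟_ w C w)
  insert-here w C with w ≟ w
  ... | yes _  = tt
  ... | no  ne = contradiction refl ne

  insert-there : ∀ w C x → T (C x) → T (insert _≟_ w C x)
  insert-there w C x t with x ≟ w
  ... | yes _ = tt
  ... | no  _ = t

Independent : ∀ {V : Set} {n} → (V → Bool) → List (Vec V n) → Set
Independent I G = ∀ {e} → e ∈ G → ¬ VecAll.All (T ∘ I) e

_⊑_ : {V : Set} → (V → Bool) → (V → Bool) → Set
I ⊑ C = ∀ v → T (I v) → T (C v)

Covers : ∀ {V : Set} {n} → List (V → Bool) → List (Vec V n) → Set
Covers 𝒞 G = ∀ I → Independent I G → ∃ λ C → C ∈ 𝒞 × I ⊑ C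

module Degree {V : Set} (_≟_ : DecidableEquality V) where

  degree : ∀ {n} → Mask n → Pattern V n → List (Vec V n) → ℕ
  degree S u = count (λ e → pattern-≟ _≟_ (restrict S e) u)

module ContainerStep
  {B V : Set} (_≟_ : DecidableEquality V) (vs : List V) (complete : ∀ v → v ∈ vs)
  (H : List B) (g : ℕ → ℕ) (κ₀ b s E L f : ℕ)
  (4≤b : 4 ≤ b) (fuel : 4 * length vs ≤ f * b) (vs≢[] : NonZero (length vs))
  (g-step : ∀ m → 1 ≤ m → m < s → b * g (suc m) ≤ g m)
  where

  open Degree _≟_

  -- Fewer than 2 ^ s masks can block a tuple; the further factor 4 in `K` leaves at most a quarter
  -- of `E` for the blocked edges in `small`.
  N K : ℕ
  N = length vs
  K = 4 * 2 ^ s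

  outside : (V → Bool) → (B → V) → ℕ
  outside C π = count (λ e → ¬? (T? (C (π e)))) H

  capacity : ∀ {j} → Vec (B → V) j → Pattern V j → ℕ
  capacity (π ∷ πs) (only x)   = κ₀ * count (λ e → π e ≟ x) H + g 1
  capacity (π ∷ πs) (skip u)   = capacity πs u
  capacity (π ∷ πs) (also x u) = g (suc (width u))

  -- A pattern in the link of a vertex is a pattern with one more vertex in the hypergraph above.
  -- Its smaller ceiling compensates the factor `b` by which the weight κ grows on the way down.
  g≤capacity : ∀ {j} (πs : Vec (B → V) j) u → j < s → b * g (suc (width u)) ≤ capacity πs u
  g≤capacity (π ∷ πs) (only x)   j<s = ≤-trans (g-step 1 ≤-refl (≤-<-trans (s≤s z≤n) j<s)) (m≤n+m _ _)
  g≤capacity (π ∷ πs) (skip u)   j<s = g≤capacity πs u (<-trans (n<1+n _) j<s)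
  g≤capacity (π ∷ πs) (also x u) j<s = g-step _ (s≤s z≤n) (≤-<-trans (s≤s (width≤length u)) j<s)

  -- At uniformity s − i this is used with κ = κ₀ bⁱ and ρ = (2K)ⁱ.
  Bounded : ∀ {j} → ℕ → ℕ → Vec (B → V) j → List (Vec V j) → Set
  Bounded κ ρ πs G = ∀ S u → κ * degree S u G ≤ ρ * capacity πs u

  -- Says that `C` misses a proportion of `H`: at one coordinate many edges have their vertex
  -- outside `C`. The term `g 1 * N` collects the constants in the capacities of single vertices and
  -- is absorbed in `outside-large`.
  Small : ∀ {j} → Vec (B → V) j → (V → Bool) → Set
  Small πs C = ∃ λ i → E ≤ L * (κ₀ * outside C (lookup πs i) + g 1 * N)

  Result : ∀ {j} → ℕ → Vec (B → V) j → List (Vec V j) → Set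
  Result M πs G = Σ (List (V → Bool)) λ 𝒞 →
    length 𝒞 ≤ M × Covers 𝒞 G × (∀ {C} → C ∈ 𝒞 → Small πs C)

  -- The bound for single vertices at the head is summed over the vertices outside `C`. Each
  -- contributes its degree in `H` at the coordinate `π` and one constant `g 1`.
  heads-outside : ∀ {j} κ ρ π (πs : Vec (B → V) j) G C → Bounded κ ρ (π ∷ πs) G →
    κ * count (λ e → ¬? (T? (C (head e)))) G ≤ ρ * (κ₀ * outside C π + g 1 * N)
  heads-outside κ ρ π πs G C bounded = ≤-trans
    (count-classwise _≟_ head π κ (ρ * κ₀) (ρ * g 1) G H vs (λ v → ¬? (T? (C v)))
      (λ _ _ → complete _) classes)
    (≤-reflexive (regroup ρ κ₀ (outside C π) (g 1) N))
    where
    regroup : ∀ ρ κ x w n → ρ * κ * x + ρ * w * n ≡ ρ * (κ * x + w * n)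
    regroup = solve-∀
    regroup′ : ∀ ρ κ x w → ρ * (κ * x + w) ≡ ρ * κ * x + ρ * w
    regroup′ = solve-∀
    classes : ∀ v → ¬ T (C v) →
      κ * count (λ e → head e ≟ v) G ≤ ρ * κ₀ * count (λ e → π e ≟ v) H + ρ * g 1
    classes v _ = begin
      κ * count (λ e → head e ≟ v) G
        ≤⟨ *-monoʳ-≤ κ (count-mono-≤ (λ e → head e ≟ v) (λ e → pattern-≟ _≟_ (restrict (only tt) e) (only v))
             (λ { (x ∷ e) refl → refl }) G) ⟩
      κ * degree (only tt) (only v) G
        ≤⟨ bounded (only tt) (only v) ⟩
      ρ * (κ₀ * count (λ e → π e ≟ v) H + g 1)
        ≡⟨ regroup′ ρ κ₀ (count (λ e → π e ≟ v) H) (g 1) ⟩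
      ρ * κ₀ * count (λ e → π e ≟ v) H + ρ * g 1 ∎
      where open ≤-Reasoning

  module UniformityStep {j} (κ ρ M : ℕ) (π : B → V) (πs : Vec (B → V) (suc j)) (G : List (Vec V (suc (suc j))))
    (j<s : suc j < s) (M>0 : 1 ≤ M) (4ρ≤L : 4 * ρ ≤ L)
    (bounded : Bounded κ ρ (π ∷ πs) G) (large : E ≤ κ * length G)
    (next : ∀ G′ → Bounded (κ * b) (ρ * (2 * K)) πs G′ → E ≤ κ * b * length G′ → Result M πs G′)
    where

    -- The threshold is half of what `Tame` permits; the other half is room for the last batch of
    -- links.
    Saturated : List (Vec V (suc j)) → Mask (suc j) → Pattern V (suc j) → Set
    Saturated G′ S u = K * (ρ * capacity πs u) ≤ κ * b * degree S u G′

    Blocked : List (Vec V (suc j)) → Vec V (suc j) → Set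
    Blocked G′ e = Any (λ S → Saturated G′ S (restrict S e)) (masks (suc j))

    saturated? : ∀ G′ S u → Dec (Saturated G′ S u)
    saturated? G′ S u = K * (ρ * capacity πs u) ≤? κ * b * degree S u G′

    blocked? : ∀ G′ → Decidable (Blocked G′)
    blocked? G′ e = any? (λ S → saturated? G′ S (restrict S e)) (masks (suc j))

    Links : V → List (Vec V (suc j)) → Vec V (suc (suc j)) → Set
    Links w G′ e = head e ≡ w × ¬ Blocked G′ (tail e)

    links? : ∀ w G′ → Decidable (Links w G′)
    links? w G′ e = head e ≟ w ×-dec ¬? (blocked? G′ (tail e))

    links : V → List (Vec V (suc j)) → List (Vec V (suc j))
    links w G′ = map tail (filter (links? w G′) G)

    length-links : ∀ w G′ → length (links w G′) ≡ count (links? w G′) G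
    length-links w G′ = trans (length-map tail (filter (links? w G′) G)) (length-filter (links? w G′) G)

    saturated-++ : ∀ F G′ S u → Saturated G′ S u → Saturated (F ++ G′) S u
    saturated-++ F G′ S u sat = ≤-trans sat (*-monoʳ-≤ (κ * b)
      (≤-trans (m≤n+m _ _) (≤-reflexive (sym (sumOver-++ _ F G′)))))

    blocked-++ : ∀ F G′ e → Blocked G′ e → Blocked (F ++ G′) e
    blocked-++ F G′ e = Any.map (λ {S} → saturated-++ F G′ S (restrict S e))

    Tame : List (Vec V (suc j)) → Set
    Tame = Bounded (κ * b) (ρ * (2 * K)) πs

    1≤K : 1 ≤ K
    1≤K = *-mono-≤ (s≤s (z≤n {3})) (m^n>0 2 s)

    -- A saturated pattern receives no new tuple. An unsaturated one is below half of its limit, and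
    -- its new tuples come from edges of `G` that also contain `w`, so that the ceiling for one
    -- vertex more fits into the other half.
    tame-links : ∀ w G′ → Tame G′ → Tame (links w G′ ++ G′)
    tame-links w G′ tame S u
      rewrite sumOver-++ (λ e → indicator (pattern-≟ _≟_ (restrict S e) u)) (links w G′) G′
      with saturated? G′ S u
    ... | yes sat = ≤-trans (≤-reflexive (cong (λ c → κ * b * (c + degree S u G′)) new≡0)) (tame S u)
      where
      new≡0 : degree S u (links w G′) ≡ 0
      new≡0 = n≤0⇒n≡0 (≤-trans
        (count-map-filter tail (links? w G′) (λ e → pattern-≟ _≟_ (restrict S e) u) (λ _ → T? false)
          (λ { e (_ , free) refl → free (Any.map (λ { refl → sat }) (∈-masks S)) }) G)
        (≤-reflexive (count-none (λ _ → T? false) (λ _ ()) G)))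
    ... | no unsat = begin
      κ * b * (degree S u (links w G′) + degree S u G′)
        ≡⟨ regroup κ b (degree S u (links w G′)) (degree S u G′) ⟩
      b * (κ * degree S u (links w G′)) + κ * b * degree S u G′
        ≤⟨ +-mono-≤ (*-monoʳ-≤ b (≤-trans (*-monoʳ-≤ κ new≤) (bounded (also tt S) (also w u)))) (<⇒≤ (≰⇒> unsat)) ⟩
      b * (ρ * g (suc (width u))) + K * (ρ * capacity πs u)
        ≡⟨ cong (_+ K * (ρ * capacity πs u)) (swap b ρ (g (suc (width u)))) ⟩
      ρ * (b * g (suc (width u))) + K * (ρ * capacity πs u)
        ≤⟨ +-monoˡ-≤ (K * (ρ * capacity πs u)) (≤-trans (*-monoʳ-≤ ρ (g≤capacity πs u j<s))
             (m≤n*m (ρ * capacity πs u) K {{>-nonZero 1≤K}})) ⟩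
      K * (ρ * capacity πs u) + K * (ρ * capacity πs u)
        ≡⟨ double K ρ (capacity πs u) ⟩
      ρ * (2 * K) * capacity πs u ∎
      where
      open ≤-Reasoning
      regroup : ∀ κ b x y → κ * b * (x + y) ≡ b * (κ * x) + κ * b * y
      regroup = solve-∀
      swap : ∀ b ρ x → b * (ρ * x) ≡ ρ * (b * x)
      swap = solve-∀
      double : ∀ K ρ x → K * (ρ * x) + K * (ρ * x) ≡ ρ * (2 * K) * x
      double = solve-∀
      new≤ : degree S u (links w G′) ≤ degree (also tt S) (also w u) G
      new≤ = count-map-filter tail (links? w G′) (λ e → pattern-≟ _≟_ (restrict S e) u)
        (λ e → pattern-≟ _≟_ (restrict (also tt S) e) (also w u))
        (λ { (x ∷ e) (refl , _) refl → refl }) G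

    tame-[] : Tame []
    tame-[] S u = ≤-trans (≤-reflexive (*-zeroʳ (κ * b))) z≤n

    -- A new tuple inside `I` would form with `w` an edge of `G` inside `I`.
    independent-links : ∀ I w G′ → T (I w) → Independent I G → Independent I G′ → Independent I (links w G′ ++ G′)
    independent-links I w G′ Iw indep indep′ e∈ with ++⁻ (links w G′) e∈
    ... | inj₂ e∈G′ = indep′ e∈G′
    ... | inj₁ e∈links with ∈-map⁻ tail e∈links
    ...   | (x ∷ e) , xe∈ , refl with ∈-filter⁻ (links? w G′) {xs = G} xe∈
    ...     | xe∈G , refl , _ = λ Ie → indep xe∈G (Iw ∷ Ie)

    -- `C` grows during the scan: it holds the light vertices, about which nothing is asked, and the
    -- heavy ones answered "yes".
    free-in : (V → Bool) → List (Vec V (suc j)) → ℕ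
    free-in C G′ = count (λ e → T? (C (head e)) ×-dec ¬? (blocked? G′ (tail e))) G

    -- Light vertices account for the first term, vertices answered "yes" for the second.
    Accounted : (V → Bool) → ℕ → List (Vec V (suc j)) → Set
    Accounted C m G′ = 4 * N * (κ * free-in C G′) ≤ m * E + 4 * N * (κ * length G′)

    -- Enlarging the collection can only block more tuples, so old edges do not become free again;
    -- those gained through `w` are its links.
    free-insert : ∀ F w C G′ → free-in (insert _≟_ w C) (F ++ G′) ≤ length (links w G′) + free-in C G′
    free-insert F w C G′ = ≤-trans
      (count-cover (λ e → T? (insert _≟_ w C (head e)) ×-dec ¬? (blocked? (F ++ G′) (tail e)))
        (links? w G′) (λ e → T? (C (head e)) ×-dec ¬? (blocked? G′ (tail e))) cover G)
      (≤-reflexive (cong (_+ free-in C G′) (sym (length-links w G′))))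
      where
      cover : ∀ e → T (insert _≟_ w C (head e)) × ¬ Blocked (F ++ G′) (tail e) →
              Links w G′ e ⊎ (T (C (head e)) × ¬ Blocked G′ (tail e))
      cover e (t , free) with insert⁻ _≟_ w C (head e) t
      ... | inj₁ eq = inj₁ (eq , free ∘ blocked-++ F G′ (tail e))
      ... | inj₂ Ce = inj₂ (Ce , free ∘ blocked-++ F G′ (tail e))

    -- At most `N` light vertices carry together at most a quarter of `E`, so they may enter the
    -- container without a question. A "yes" for any other vertex enlarges the collection
    -- noticeably, which limits the number of such answers.
    Light : V → List (Vec V (suc j)) → Set
    Light w G′ = 4 * N * (κ * length (links w G′)) ≤ E

    account-light : ∀ w C m G′ → Light w G′ → Accounted C m G′ → Accounted (insert _≟_ w C) (suc m) G′
    account-light w C m G′ light acc = begin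
      4 * N * (κ * free-in (insert _≟_ w C) G′)
        ≤⟨ *-monoʳ-≤ (4 * N) (*-monoʳ-≤ κ (free-insert [] w C G′)) ⟩
      4 * N * (κ * (length (links w G′) + free-in C G′))
        ≡⟨ regroup (4 * N) κ (length (links w G′)) (free-in C G′) ⟩
      4 * N * (κ * length (links w G′)) + 4 * N * (κ * free-in C G′)
        ≤⟨ +-mono-≤ light acc ⟩
      E + (m * E + 4 * N * (κ * length G′))
        ≡⟨ sym (+-assoc E (m * E) _) ⟩
      suc m * E + 4 * N * (κ * length G′) ∎
      where
      open ≤-Reasoning
      regroup : ∀ c κ x y → c * (κ * (x + y)) ≡ c * (κ * x) + c * (κ * y)
      regroup = solve-∀

    account-yes : ∀ w C m G′ → Accounted C m G′ → Accounted (insert _≟_ w C) (suc m) (links w G′ ++ G′)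
    account-yes w C m G′ acc = begin
      4 * N * (κ * free-in (insert _≟_ w C) (links w G′ ++ G′))
        ≤⟨ *-monoʳ-≤ (4 * N) (*-monoʳ-≤ κ (free-insert (links w G′) w C G′)) ⟩
      4 * N * (κ * (length (links w G′) + free-in C G′))
        ≡⟨ regroup (4 * N) κ (length (links w G′)) (free-in C G′) ⟩
      4 * N * (κ * free-in C G′) + 4 * N * (κ * length (links w G′))
        ≤⟨ +-monoˡ-≤ _ acc ⟩
      m * E + 4 * N * (κ * length G′) + 4 * N * (κ * length (links w G′))
        ≤⟨ m≤n+m _ E ⟩
      E + (m * E + 4 * N * (κ * length G′) + 4 * N * (κ * length (links w G′)))
        ≡⟨ regroup′ E m (4 * N) κ (length G′) (length (links w G′)) ⟩
      suc m * E + 4 * N * (κ * (length (links w G′) + length G′))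
        ≡⟨ cong (λ l → suc m * E + 4 * N * (κ * l)) (sym (length-++ (links w G′))) ⟩
      suc m * E + 4 * N * (κ * length (links w G′ ++ G′)) ∎
      where
      open ≤-Reasoning
      regroup : ∀ c κ x y → c * (κ * (x + y)) ≡ c * (κ * y) + c * (κ * x)
      regroup = solve-∀
      regroup′ : ∀ E m c κ x y → E + (m * E + c * (κ * x) + c * (κ * y)) ≡ suc m * E + c * (κ * (y + x))
      regroup′ = solve-∀

    -- Double counting. By `bounded`, the number of edges of `G` over a saturated pattern is at most
    -- its degree in `G′` times b / K. For a fixed mask the classes of different patterns are
    -- disjoint in `G′`, and there are fewer than 2 ^ s masks.
    blocked-few : ∀ G′ → κ * (K * count (λ e → blocked? G′ (tail e)) G) ≤ 2 ^ s * (κ * b * length G′)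
    blocked-few G′ = begin
      κ * (K * count (λ e → blocked? G′ (tail e)) G)
        ≤⟨ *-monoʳ-≤ κ (*-monoʳ-≤ K (count-Any (λ S e → saturated? G′ S (restrict S (tail e)))
             (λ Ss e → any? (λ S → saturated? G′ S (restrict S (tail e))) Ss) (masks (suc j)) G)) ⟩
      κ * (K * sumOver (λ S → count (λ e → saturated? G′ S (restrict S (tail e))) G) (masks (suc j)))
        ≡⟨ sym (trans (sumOver-*ˡ κ _ (masks (suc j))) (cong (κ *_) (sumOver-*ˡ K _ (masks (suc j))))) ⟩
      sumOver (λ S → κ * (K * count (λ e → saturated? G′ S (restrict S (tail e))) G)) (masks (suc j))
        ≤⟨ sumOver-mono-≤ class (masks (suc j)) ⟩
      sumOver (λ S → κ * b * length G′) (masks (suc j))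
        ≡⟨ sumOver-const _ (masks (suc j)) ⟩
      length (masks (suc j)) * (κ * b * length G′)
        ≤⟨ *-monoˡ-≤ (κ * b * length G′) (≤-trans (≤-trans (n≤1+n _) (≤-reflexive (length-masks (suc j))))
             (^-monoʳ-≤ 2 (<⇒≤ j<s))) ⟩
      2 ^ s * (κ * b * length G′) ∎
      where
      open ≤-Reasoning
      rearrange : ∀ κ K x → κ * K * x ≡ K * (κ * x)
      rearrange = solve-∀
      class : ∀ S → κ * (K * count (λ e → saturated? G′ S (restrict S (tail e))) G) ≤ κ * b * length G′
      class S = begin
        κ * (K * count (λ e → saturated? G′ S (restrict S (tail e))) G)
          ≡⟨ sym (*-assoc κ K _) ⟩
        κ * K * count (λ e → saturated? G′ S (restrict S (tail e))) G
          ≤⟨ count-classwise (pattern-≟ _≟_) (λ e → restrict S (tail e)) (restrict S) (κ * K) (κ * b) 0 G G′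
               (map (λ e → restrict S (tail e)) G) (saturated? G′ S)
               (λ e∈ _ → ∈-map⁺ _ e∈) each ⟩
        κ * b * count (λ e → saturated? G′ S (restrict S e)) G′ + 0
          ≡⟨ +-identityʳ _ ⟩
        κ * b * count (λ e → saturated? G′ S (restrict S e)) G′
          ≤⟨ *-monoʳ-≤ (κ * b) (count≤length _ G′) ⟩
        κ * b * length G′ ∎
        where
        each : ∀ u → Saturated G′ S u →
          κ * K * count (λ e → pattern-≟ _≟_ (restrict S (tail e)) u) G ≤ κ * b * degree S u G′ + 0
        each u sat = begin
          κ * K * count (λ e → pattern-≟ _≟_ (restrict S (tail e)) u) G
            ≡⟨ rearrange κ K _ ⟩
          K * (κ * count (λ e → pattern-≟ _≟_ (restrict S (tail e)) u) G)
            ≤⟨ *-monoʳ-≤ K (*-monoʳ-≤ κ (count-mono-≤ _ (λ e → pattern-≟ _≟_ (restrict (skip S) e) (skip u))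
                 (λ { (x ∷ e) refl → refl }) G)) ⟩
          K * (κ * degree (skip S) (skip u) G)
            ≤⟨ *-monoʳ-≤ K (bounded (skip S) (skip u)) ⟩
          K * (ρ * capacity πs u)
            ≤⟨ sat ⟩
          κ * b * degree S u G′
            ≡⟨ sym (+-identityʳ _) ⟩
          κ * b * degree S u G′ + 0 ∎

    -- Every edge of `G` is free, blocked, or has its head outside `C`. Out of the total weight 4
    -- `E`, free edges take at most 2 `E` and blocked ones at most `E`, so at least `E` is left for
    -- the heads outside.
    small : ∀ C m G′ → m ≤ N → Accounted C m G′ → κ * b * length G′ < E → Small (π ∷ πs) C
    small C m G′ m≤N acc G′<E = zero , (begin
      E
        ≤⟨ +-cancelʳ-≤ (3 * E) E (4 * (κ * out)) (begin
             E + 3 * E ≤⟨ *-monoʳ-≤ 4 large ⟩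
             4 * (κ * length G) ≤⟨ *-monoʳ-≤ 4 (*-monoʳ-≤ κ split) ⟩
             4 * (κ * (free + (blk + out))) ≡⟨ spread κ free blk out ⟩
             4 * (κ * free) + 4 * (κ * blk) + 4 * (κ * out) ≤⟨ +-monoˡ-≤ (4 * (κ * out)) (+-mono-≤ free≤ blk≤) ⟩
             2 * E + E + 4 * (κ * out) ≡⟨ regroup E (4 * (κ * out)) ⟩
             4 * (κ * out) + 3 * E ∎) ⟩
      4 * (κ * out)
        ≤⟨ *-monoʳ-≤ 4 (heads-outside κ ρ π πs G C bounded) ⟩
      4 * (ρ * (κ₀ * outside C π + g 1 * N))
        ≡⟨ sym (*-assoc 4 ρ _) ⟩
      4 * ρ * (κ₀ * outside C π + g 1 * N)
        ≤⟨ *-monoˡ-≤ _ 4ρ≤L ⟩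
      L * (κ₀ * outside C π + g 1 * N) ∎)
      where
      open ≤-Reasoning
      out free blk : ℕ
      out  = count (λ e → ¬? (T? (C (head e)))) G
      free = free-in C G′
      blk  = count (λ e → blocked? G′ (tail e)) G
      spread : ∀ κ a b c → 4 * (κ * (a + (b + c))) ≡ 4 * (κ * a) + 4 * (κ * b) + 4 * (κ * c)
      spread = solve-∀
      regroup : ∀ E x → 2 * E + E + x ≡ x + 3 * E
      regroup = solve-∀
      split : length G ≤ free + (blk + out)
      split = begin
        length G ≡⟨ sym (count-all (λ _ → yes tt) G (λ _ → tt)) ⟩
        count (λ _ → yes tt) G
          ≤⟨ count-cover (λ _ → yes tt) (λ e → T? (C (head e)) ×-dec ¬? (blocked? G′ (tail e)))
               (λ e → ¬? (T? (C (head e)) ×-dec ¬? (blocked? G′ (tail e)))) dec G ⟩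
        free + count (λ e → ¬? (T? (C (head e)) ×-dec ¬? (blocked? G′ (tail e)))) G
          ≤⟨ +-monoʳ-≤ free (count-cover _ (λ e → blocked? G′ (tail e)) (λ e → ¬? (T? (C (head e)))) dec′ G) ⟩
        free + (blk + out) ∎
        where
        dec : ∀ e → ⊤ → (T (C (head e)) × ¬ Blocked G′ (tail e)) ⊎ ¬ (T (C (head e)) × ¬ Blocked G′ (tail e))
        dec e _ with T? (C (head e)) ×-dec ¬? (blocked? G′ (tail e))
        ... | yes p = inj₁ p
        ... | no ¬p = inj₂ ¬p
        dec′ : ∀ e → ¬ (T (C (head e)) × ¬ Blocked G′ (tail e)) → Blocked G′ (tail e) ⊎ ¬ T (C (head e))
        dec′ e ¬p with blocked? G′ (tail e)
        ... | yes p = inj₁ p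
        ... | no ¬q = inj₂ (λ t → ¬p (t , ¬q))
      free≤ : 4 * (κ * free) ≤ 2 * E
      free≤ = *-cancelˡ-≤ N {{vs≢[]}} (begin
        N * (4 * (κ * free)) ≡⟨ r₁ N (κ * free) ⟩
        4 * N * (κ * free) ≤⟨ acc ⟩
        m * E + 4 * N * (κ * length G′) ≤⟨ +-mono-≤ (*-monoˡ-≤ E m≤N) (≤-reflexive (r₂ N (κ * length G′))) ⟩
        N * E + N * (4 * (κ * length G′)) ≤⟨ +-monoʳ-≤ (N * E) (*-monoʳ-≤ N (begin
             -- Since the collection stayed below the recursion threshold and 4 ≤ b, the answers
             -- "yes" contribute no more than the light vertices.
             4 * (κ * length G′) ≤⟨ *-monoˡ-≤ (κ * length G′) 4≤b ⟩
             b * (κ * length G′) ≡⟨ r₃ b κ (length G′) ⟩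
             κ * b * length G′ ≤⟨ <⇒≤ G′<E ⟩
             E ∎)) ⟩
        N * E + N * E ≡⟨ r₄ N E ⟩
        N * (2 * E) ∎)
        where
        r₁ : ∀ N x → N * (4 * x) ≡ 4 * N * x
        r₁ = solve-∀
        r₂ : ∀ N x → 4 * N * x ≡ N * (4 * x)
        r₂ = solve-∀
        r₃ : ∀ b κ x → b * (κ * x) ≡ κ * b * x
        r₃ = solve-∀
        r₄ : ∀ N E → N * E + N * E ≡ N * (2 * E)
        r₄ = solve-∀
      blk≤ : 4 * (κ * blk) ≤ E
      blk≤ = *-cancelˡ-≤ (2 ^ s) {{m^n≢0 2 s}} (begin
        2 ^ s * (4 * (κ * blk)) ≡⟨ r (2 ^ s) κ blk ⟩
        κ * (K * blk) ≤⟨ blocked-few G′ ⟩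
        2 ^ s * (κ * b * length G′) ≤⟨ *-monoʳ-≤ (2 ^ s) (<⇒≤ G′<E) ⟩
        2 ^ s * E ∎)
        where
        r : ∀ p κ x → p * (4 * (κ * x)) ≡ κ * (4 * p * x)
        r = solve-∀

    -- `f′` is the number of answers "yes" still available. Each raises κ b |G′| by at least b E /
    -- (4N), so when none is left the collection has reached `E`.
    Fuel : ℕ → List (Vec V (suc j)) → Set
    Fuel f′ G′ = 4 * N * E ≤ 4 * N * (κ * b * length G′) + f′ * (b * E)

    fuel-yes : ∀ w f′ G′ → ¬ Light w G′ → Fuel (suc f′) G′ → Fuel f′ (links w G′ ++ G′)
    fuel-yes w f′ G′ heavy enough = begin
      4 * N * E
        ≤⟨ enough ⟩
      4 * N * (κ * b * length G′) + (b * E + f′ * (b * E))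
        ≤⟨ +-monoʳ-≤ (4 * N * (κ * b * length G′)) (+-monoˡ-≤ (f′ * (b * E)) (*-monoʳ-≤ b (<⇒≤ (≰⇒> heavy)))) ⟩
      4 * N * (κ * b * length G′) + (b * (4 * N * (κ * length (links w G′))) + f′ * (b * E))
        ≡⟨ regroup N κ b (length G′) (length (links w G′)) (f′ * (b * E)) ⟩
      4 * N * (κ * b * (length (links w G′) + length G′)) + f′ * (b * E)
        ≡⟨ cong (λ l → 4 * N * (κ * b * l) + f′ * (b * E)) (sym (length-++ (links w G′))) ⟩
      4 * N * (κ * b * length (links w G′ ++ G′)) + f′ * (b * E) ∎
      where
      open ≤-Reasoning
      regroup : ∀ N κ b x y z → 4 * N * (κ * b * x) + (b * (4 * N * (κ * y)) + z) ≡ 4 * N * (κ * b * (y + x)) + z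
      regroup = solve-∀

    fuel-empty : ∀ G′ → Fuel 0 G′ → E ≤ κ * b * length G′
    fuel-empty G′ enough = *-cancelˡ-≤ (4 * N) {{m*n≢0 4 N {{_}} {{vs≢[]}}}}
      (≤-trans enough (≤-reflexive (+-identityʳ _)))

    -- Invariant of the scan: `D` has to keep the members of `I` already in `C` or still to come.
    -- Vertices answered "no" are in neither place; the answers "yes" survive as the independence of
    -- `I` in `G′`.
    CoversFrom : List (V → Bool) → List V → List (Vec V (suc j)) → (V → Bool) → Set
    CoversFrom 𝒞 ws G′ C = ∀ I → Independent I G → Independent I G′ →
      ∃ λ D → D ∈ 𝒞 × (∀ v → T (I v) → T (C v) ⊎ v ∈ ws → T (D v))

    Outcome : List V → ℕ → List (Vec V (suc j)) → (V → Bool) → Set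
    Outcome ws f′ G′ C = Σ (List (V → Bool)) λ 𝒞 →
      length 𝒞 ≤ suc (length ws) ^ f′ * M × CoversFrom 𝒞 ws G′ C × (∀ {D} → D ∈ 𝒞 → Small (π ∷ πs) D)

    finish : ∀ ws f′ G′ C → Result M πs G′ → Outcome ws f′ G′ C
    finish ws f′ G′ C (𝒞 , count𝒞 , covers , smalls) =
      𝒞 , ≤-trans count𝒞 (m≤n*m M (suc (length ws) ^ f′) {{m^n≢0 (suc (length ws)) f′}}) ,
      (λ I _ indep′ → let D , D∈ , I⊑D = covers I indep′ in D , D∈ , λ v Iv _ → I⊑D v Iv) ,
      (λ D∈ → let i , bound = smalls D∈ in suc i , bound)

    leaf : ∀ f′ G′ C → Small (π ∷ πs) C → Outcome [] f′ G′ C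
    leaf f′ G′ C C-small =
      C ∷ [] ,
      ≤-trans M>0 (m≤n*m M (1 ^ f′) {{m^n≢0 1 f′}}) ,
      (λ I _ _ → C , here refl , λ { v _ (inj₁ Cv) → Cv ; v _ (inj₂ ()) }) ,
      (λ { (here refl) → C-small })

    insert-covers : ∀ w ws (C D I : V → Bool) →
      (∀ v → T (I v) → T (insert _≟_ w C v) ⊎ v ∈ ws → T (D v)) →
      ∀ v → T (I v) → T (C v) ⊎ v ∈ w ∷ ws → T (D v)
    insert-covers w ws C D I I⊑D v Iv (inj₁ Cv)           = I⊑D v Iv (inj₁ (insert-there _≟_ w C v Cv))
    insert-covers w ws C D I I⊑D v Iv (inj₂ (here refl))  = I⊑D v Iv (inj₁ (insert-here _≟_ w C))
    insert-covers w ws C D I I⊑D v Iv (inj₂ (there v∈ws)) = I⊑D v Iv (inj₂ v∈ws)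

    extend : ∀ w ws f′ G′ C → Outcome ws f′ G′ (insert _≟_ w C) → Outcome (w ∷ ws) f′ G′ C
    extend w ws f′ G′ C (𝒞 , count𝒞 , covers , smalls) =
      𝒞 , ≤-trans count𝒞 (*-monoˡ-≤ M (^-monoˡ-≤ f′ (n≤1+n (suc (length ws))))) ,
      (λ I indep indep′ → let D , D∈ , I⊑D = covers I indep indep′ in D , D∈ , insert-covers w ws C D I I⊑D) ,
      smalls

    -- Only "yes" spends fuel, so the numbers of outcomes obey l · l^f + l^f ≤ (l + 1)^(f + 1),
    -- where l is one more than the number of vertices left.
    branch : ∀ w ws f′ G′ C → Outcome ws (suc f′) G′ C → Outcome ws f′ (links w G′ ++ G′) (insert _≟_ w C) →
             Outcome (w ∷ ws) (suc f′) G′ C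
    branch w ws f′ G′ C (𝒞₀ , count₀ , covers₀ , smalls₀) (𝒞₁ , count₁ , covers₁ , smalls₁) =
      𝒞₀ ++ 𝒞₁ , count≤ , covers , ([ smalls₀ , smalls₁ ]′ ∘ ++⁻ 𝒞₀)
      where
      open ≤-Reasoning
      l : ℕ
      l = suc (length ws)
      regroup : ∀ l x M → l * x * M + x * M ≡ suc l * x * M
      regroup = solve-∀
      count≤ : length (𝒞₀ ++ 𝒞₁) ≤ suc l ^ suc f′ * M
      count≤ = begin
        length (𝒞₀ ++ 𝒞₁) ≡⟨ length-++ 𝒞₀ ⟩
        length 𝒞₀ + length 𝒞₁ ≤⟨ +-mono-≤ count₀ count₁ ⟩
        l * l ^ f′ * M + l ^ f′ * M ≡⟨ regroup l (l ^ f′) M ⟩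
        suc l * l ^ f′ * M ≤⟨ *-monoˡ-≤ M (*-monoʳ-≤ (suc l) (^-monoˡ-≤ f′ (n≤1+n l))) ⟩
        suc l * suc l ^ f′ * M ∎
      answer : ∀ I → Dec (T (I w)) → Independent I G → Independent I G′ →
        ∃ λ D → D ∈ 𝒞₀ ++ 𝒞₁ × (∀ v → T (I v) → T (C v) ⊎ v ∈ w ∷ ws → T (D v))
      answer I (no ¬Iw) indep indep′ = let D , D∈ , I⊑D = covers₀ I indep indep′ in D , ++⁺ˡ D∈ ,
        λ { v Iv (inj₁ Cv)           → I⊑D v Iv (inj₁ Cv)
          ; v Iv (inj₂ (here refl))  → contradiction Iv ¬Iw
          ; v Iv (inj₂ (there v∈ws)) → I⊑D v Iv (inj₂ v∈ws) }
      answer I (yes Iw) indep indep′ =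
        let D , D∈ , I⊑D = covers₁ I indep (independent-links I w G′ Iw indep indep′) in
        D , ++⁺ʳ 𝒞₀ D∈ , insert-covers w ws C D I I⊑D
      covers : CoversFrom (𝒞₀ ++ 𝒞₁) (w ∷ ws) G′ C
      covers I = answer I (T? (I w))

    -- `m` counts the vertices put into `C`. The size test comes first: without fuel the collection
    -- must be large, and once all vertices are scanned with the collection still not large, `C` is
    -- a container.
    explore : ∀ ws f′ G′ C m → Dec (E ≤ κ * b * length G′) →
      Tame G′ → Fuel f′ G′ → m + length ws ≤ N → Accounted C m G′ → Outcome ws f′ G′ C
    explore-vertex : ∀ w ws f′ G′ C m → Dec (Light w G′) →
      Tame G′ → Fuel (suc f′) G′ → m + suc (length ws) ≤ N → Accounted C m G′ → Outcome (w ∷ ws) (suc f′) G′ C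

    explore ws f′ G′ C m (yes G′-large) tame _ _ _ = finish ws f′ G′ C (next G′ tame G′-large)
    explore ws zero G′ C m (no ¬large) _ enough _ _ = contradiction (fuel-empty G′ enough) ¬large
    explore [] (suc f′) G′ C m (no ¬large) _ _ m≤N acc =
      leaf (suc f′) G′ C (small C m G′ (≤-trans (m≤m+n m 0) m≤N) acc (≰⇒> ¬large))
    explore (w ∷ ws) (suc f′) G′ C m (no _) = explore-vertex w ws f′ G′ C m (_ ≤? E)

    explore-vertex w ws f′ G′ C m (yes light) tame enough m≤N acc = extend w ws (suc f′) G′ C
      (explore ws (suc f′) G′ (insert _≟_ w C) (suc m) (E ≤? _) tame enough
        (≤-trans (≤-reflexive (sym (+-suc m (length ws)))) m≤N) (account-light w C m G′ light acc))
    explore-vertex w ws f′ G′ C m (no heavy) tame enough m≤N acc = branch w ws f′ G′ C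
      (explore ws (suc f′) G′ C m (E ≤? _) tame enough (≤-trans (+-monoʳ-≤ m (n≤1+n (length ws))) m≤N) acc)
      (explore ws f′ (links w G′ ++ G′) (insert _≟_ w C) (suc m) (E ≤? _) (tame-links w G′ tame)
        (fuel-yes w f′ G′ heavy enough)
        (≤-trans (≤-reflexive (sym (+-suc m (length ws)))) m≤N) (account-yes w C m G′ acc))

    fuel-start : Fuel f []
    fuel-start = ≤-trans (*-monoˡ-≤ E fuel)
      (≤-trans (≤-reflexive (*-assoc f b E)) (m≤n+m _ _))

    account-start : Accounted (λ _ → false) 0 []
    account-start = ≤-reflexive (cong (λ c → 4 * N * (κ * c))
      (count-none (λ e → T? false ×-dec ¬? (blocked? [] (tail e))) (λ _ → proj₁) G))

    whole : ∀ C → Outcome vs f [] C → Result (suc N ^ f * M) (π ∷ πs) G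
    whole C (𝒞 , count𝒞 , covers , smalls) =
      𝒞 , count𝒞 ,
      (λ I indep → let D , D∈ , I⊑D = covers I indep (λ ()) in D , D∈ , λ v Iv → I⊑D v Iv (inj₂ (complete v))) ,
      smalls

    level : Result (suc N ^ f * M) (π ∷ πs) G
    level = whole (λ _ → false)
      (explore vs f [] (λ _ → false) 0 (E ≤? _) tame-[] fuel-start ≤-refl account-start)

  -- Induction on the uniformity j + 1. In uniformity 1 an independent set avoids every head, so the
  -- complement of the heads is the only container, and all of `G` lies outside it. Each further
  -- level multiplies the number of containers by (N + 1) ^ f.
  containers : ∀ j κ ρ (πs : Vec (B → V) (suc j)) G → j < s → 4 * (ρ * (2 * K) ^ j) ≤ L →
               Bounded κ ρ πs G → E ≤ κ * length G → Result ((suc N ^ f) ^ j) πs G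
  containers zero κ ρ (π ∷ []) G j<s 4ρ≤L bounded large =
    C ∷ [] , ≤-refl , (λ I indep → C , here refl , covers I indep) ,
    λ { (here refl) → zero , bound }
    where
    open ≤-Reasoning
    isHead? : ∀ v → Dec (Any (λ e → head e ≡ v) G)
    isHead? v = any? (λ e → head e ≟ v) G
    C : V → Bool
    C v = does (¬? (isHead? v))
    covers : ∀ I → Independent I G → I ⊑ C
    covers I indep v Iv with isHead? v
    ... | no _ = tt
    ... | yes p with find p
    ...   | x ∷ [] , e∈G , refl = contradiction (Iv ∷ []) (indep e∈G)
    all-outside : ∀ {e} → e ∈ G → ¬ T (C (head e))
    all-outside {e} e∈G t with isHead? (head e)
    ... | no ¬p = ¬p (Any.map (λ eq → cong head (sym eq)) e∈G)
    bound : E ≤ L * (κ₀ * outside C π + g 1 * N)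
    bound = begin
      E ≤⟨ large ⟩
      κ * length G ≡⟨ cong (κ *_) (sym (count-all (λ e → ¬? (T? (C (head e)))) G all-outside)) ⟩
      κ * count (λ e → ¬? (T? (C (head e)))) G ≤⟨ heads-outside κ ρ π [] G C bounded ⟩
      ρ * (κ₀ * outside C π + g 1 * N)
        ≤⟨ *-monoˡ-≤ _ (≤-trans (≤-trans (m≤m*n ρ 1) (m≤n*m (ρ * 1) 4)) 4ρ≤L) ⟩
      L * (κ₀ * outside C π + g 1 * N) ∎
  containers (suc j) κ ρ (π ∷ πs) G j<s 4ρ≤L bounded large =
    UniformityStep.level κ ρ ((suc N ^ f) ^ j) π πs G j<s (m^n>0 (suc N ^ f) {{m^n≢0 (suc N) f}} j)
      (≤-trans (*-monoʳ-≤ 4 (m≤m*n ρ ((2 * K) ^ suc j) {{m^n≢0 (2 * K) (suc j) {{2K≢0}}}})) 4ρ≤L)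
      bounded large
      (λ G′ → containers j (κ * b) (ρ * (2 * K)) πs G′ (<-trans (n<1+n j) j<s)
        (≤-trans (≤-reflexive (cong (4 *_) (*-assoc ρ (2 * K) ((2 * K) ^ j)))) 4ρ≤L))
    where
    2K≢0 : NonZero (2 * K)
    2K≢0 = m*n≢0 2 K {{_}} {{m*n≢0 4 (2 ^ s) {{_}} {{m^n≢0 2 s}}}}

-- Iterating the container step

-- The positions are read off the shape of `u`. Codegree hypotheses take this form because the
-- degree of `u` under any mask is at most its number of matches.
Match : ∀ {V : Set} {n} → Pattern V n → Vec V n → Set
Match (only x)   (y ∷ ys) = y ≡ x
Match (skip u)   (y ∷ ys) = Match u ys
Match (also x u) (y ∷ ys) = y ≡ x × Match u ys

match? : ∀ {V : Set} → DecidableEquality V → ∀ {n} (u : Pattern V n) → Decidable (Match u)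
match? _≟_ (only x)   (y ∷ ys) = y ≟ x
match? _≟_ (skip u)   (y ∷ ys) = match? _≟_ u ys
match? _≟_ (also x u) (y ∷ ys) = y ≟ x ×-dec match? _≟_ u ys

restrict-match : ∀ {V : Set} {n} S (u : Pattern V n) xs → restrict S xs ≡ u → Match u xs
restrict-match (only _)   _ (x ∷ xs) refl = refl
restrict-match (skip S)   _ (x ∷ xs) refl = restrict-match S _ xs refl
restrict-match (also _ S) _ (x ∷ xs) refl = refl , restrict-match S _ xs refl

contained? : ∀ {V : Set} {n} (C : V → Bool) → Decidable (VecAll.All (T ∘ C) {n})
contained? C = VecAll.all? (λ v → T? (C v))

induced : ∀ {V : Set} {n} → (V → Bool) → List (Vec V n) → List (Vec V n)
induced C = filter (contained? C)

-- 4 · 2^s outweighs the number of masks, and each of the s levels costs a factor 2 (4 · 2^s).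
abstract

  decay : ℕ → ℕ
  decay s = 8 * (2 * (4 * 2 ^ s)) ^ s

  decay≡ : ∀ s → decay s ≡ 8 * (2 * (4 * 2 ^ s)) ^ s
  decay≡ s = refl

  8≤decay : ∀ s → 8 ≤ decay s
  8≤decay s = m≤m*n 8 _ {{m^n≢0 (2 * (4 * 2 ^ s)) s {{m*n≢0 2 _ {{_}} {{m*n≢0 4 _ {{_}} {{m^n≢0 2 s}}}}}}}}

decay≢0 : ∀ s → NonZero (decay s)
decay≢0 s = >-nonZero (≤-trans (s≤s z≤n) (8≤decay s))

module Iteration
  {V : Set} (_≟_ : DecidableEquality V) (vs : List V) (complete : ∀ v → v ∈ vs)
  (j b f : ℕ) (4≤b : 4 ≤ b) (fuel : 4 * length vs ≤ f * b) (vs≢[] : NonZero (length vs))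
  where

  private
    s N p : ℕ
    s = suc j
    N = length vs
    p = (2 * (4 * 2 ^ s)) ^ s

    b≢0 : NonZero b
    b≢0 = >-nonZero (≤-trans (s≤s z≤n) 4≤b)

  module OneStep (H : List (Vec V s))
    (codegree : ∀ u → 2 ≤ width u → decay s * N * b ^ (width u ∸ 1) * count (match? _≟_ u) H ≤ length H)
    where

    -- `κ₀ * e` serves as the threshold `E`, which `H` itself meets with equality.
    e κ₀ : ℕ
    e  = length H
    κ₀ = decay s * b ^ s * N

    -- Chosen so that `b * g (suc m)` equals `g m` below `s`, and so that the codegree hypothesis
    -- for width m says that κ₀ times the degree is at most `g m`.
    g : ℕ → ℕ
    g m = b ^ (suc s ∸ m) * e

    g-step : ∀ m → 1 ≤ m → m < s → b * g (suc m) ≤ g m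
    g-step m _ m<s = ≤-reflexive (trans (sym (*-assoc b (b ^ (s ∸ m)) e))
      (cong (λ x → b ^ x * e) (sym (+-∸-assoc 1 (<⇒≤ m<s)))))

    open ContainerStep _≟_ vs complete H g κ₀ b s (κ₀ * e) (4 * p) f 4≤b fuel vs≢[] g-step
      hiding (N)

    projections : Vec (Vec V s → V) s
    projections = tabulate (λ i xs → lookup xs i)

    projections-apply : ∀ xs → Vec.map (λ π → π xs) projections ≡ xs
    projections-apply xs = trans (sym (tabulate-∘ (λ π → π xs) (λ i ys → lookup ys i))) (tabulate∘lookup xs)

    -- For a single vertex the degree is itself part of the capacity; a hypothesis enters from width
    -- 2 on.
    capacity-bound : ∀ {n} (πs : Vec (Vec V s → V) n) u {P : Pred (Vec V s) _} (P? : Decidable P) →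
      (∀ xs → P xs → Match u (Vec.map (λ π → π xs) πs)) →
      (2 ≤ width u → κ₀ * count P? H ≤ g (width u)) → κ₀ * count P? H ≤ capacity πs u
    capacity-bound (π ∷ πs) (only x)   P? imp _   =
      ≤-trans (*-monoʳ-≤ κ₀ (count-mono-≤ P? (λ xs → π xs ≟ x) imp H)) (m≤m+n _ _)
    capacity-bound (π ∷ πs) (skip u)   P? imp big = capacity-bound πs u P? imp big
    capacity-bound (π ∷ πs) (also x u) P? imp big = big (s≤s (width≥1 u))

    κ₀-codegree : ∀ u → 2 ≤ width u → κ₀ * count (match? _≟_ u) H ≤ g (width u)
    κ₀-codegree u 2≤m = begin
      decay s * b ^ s * N * c
        ≡⟨ cong (λ x → decay s * b ^ x * N * c) (sym exponent) ⟩
      decay s * b ^ (suc s ∸ m + (m ∸ 1)) * N * c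
        ≡⟨ cong (λ x → decay s * x * N * c) (^-distribˡ-+-* b (suc s ∸ m) (m ∸ 1)) ⟩
      decay s * (b ^ (suc s ∸ m) * b ^ (m ∸ 1)) * N * c
        ≡⟨ regroup (decay s) (b ^ (suc s ∸ m)) (b ^ (m ∸ 1)) N c ⟩
      b ^ (suc s ∸ m) * (decay s * N * b ^ (m ∸ 1) * c)
        ≤⟨ *-monoʳ-≤ (b ^ (suc s ∸ m)) (codegree u 2≤m) ⟩
      b ^ (suc s ∸ m) * e ∎
      where
      open ≤-Reasoning
      c m : ℕ
      c = count (match? _≟_ u) H
      m = width u
      regroup : ∀ d x y n c → d * (x * y) * n * c ≡ x * (d * n * y * c)
      regroup = solve-∀
      exponent : suc s ∸ m + (m ∸ 1) ≡ s
      exponent with m | width≥1 u | width≤length u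
      ... | suc m′ | _ | s≤s m′≤j = m∸n+n≡m (≤-trans m′≤j (n≤1+n j))

    bounded : Bounded κ₀ 1 projections H
    bounded S u = begin
      κ₀ * count (λ xs → pattern-≟ _≟_ (restrict S xs) u) H
        ≤⟨ *-monoʳ-≤ κ₀ (count-mono-≤ _ (match? _≟_ u) (λ xs → restrict-match S u xs) H) ⟩
      κ₀ * count (match? _≟_ u) H
        ≤⟨ capacity-bound projections u (match? _≟_ u)
             (λ xs → subst (Match u) (sym (projections-apply xs))) (κ₀-codegree u) ⟩
      capacity projections u
        ≡⟨ sym (*-identityˡ _) ⟩
      1 * capacity projections u ∎
      where open ≤-Reasoning

    κ₀≢0 : NonZero κ₀
    κ₀≢0 = m*n≢0 _ N {{m*n≢0 _ _ {{decay≢0 s}} {{m^n≢0 b s {{b≢0}}}}}} {{vs≢[]}}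

    -- Because `decay s` is 8p, the error 4p · `g 1 * N` is exactly half of `κ₀ * e`. Adding the
    -- inequality to itself therefore cancels one copy of `κ₀ * e`.
    outside-large : ∀ x → κ₀ * e ≤ 4 * p * (κ₀ * x + g 1 * N) → e ≤ decay s * x
    outside-large x bound = *-cancelˡ-≤ κ₀ {{κ₀≢0}} (+-cancelʳ-≤ (κ₀ * e) _ _ (begin
      κ₀ * e + κ₀ * e
        ≤⟨ +-mono-≤ bound bound ⟩
      4 * p * (κ₀ * x + b ^ s * e * N) + 4 * p * (κ₀ * x + b ^ s * e * N)
        ≡⟨ subst (λ D → 4 * p * (D * b ^ s * N * x + b ^ s * e * N) + 4 * p * (D * b ^ s * N * x + b ^ s * e * N)
                          ≡ D * b ^ s * N * (D * x) + D * b ^ s * N * e) (sym (decay≡ s)) (regroup p (b ^ s) N e x) ⟩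
      κ₀ * (decay s * x) + κ₀ * e ∎))
      where
      open ≤-Reasoning
      regroup : ∀ p q n e x →
        4 * p * (8 * p * q * n * x + q * e * n) + 4 * p * (8 * p * q * n * x + q * e * n)
          ≡ 8 * p * q * n * (8 * p * x) + 8 * p * q * n * e
      regroup = solve-∀

    shrinks : ∀ C → Small projections C → decay s * length (induced C H) + e ≤ decay s * e
    shrinks C (i , bound) = begin
      decay s * length (induced C H) + e
        ≤⟨ +-mono-≤ (≤-reflexive (cong (decay s *_) (length-filter (contained? C) H)))
             (outside-large _ bound) ⟩
      decay s * count (contained? C) H + decay s * outside C (lookup projections i)
        ≡⟨ sym (*-distribˡ-+ (decay s) _ _) ⟩
      decay s * (count (contained? C) H + outside C (lookup projections i))
        ≤⟨ *-monoʳ-≤ (decay s) (count-disjoint (contained? C) (λ xs → ¬? (T? (C (lookup projections i xs))))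
             (λ xs all ¬Cx → ¬Cx (subst (T ∘ C) (sym (cong (λ π → π xs) (lookup∘tabulate (λ i xs → lookup xs i) i)))
               (lookup⁺ all i))) H) ⟩
      decay s * e ∎
      where open ≤-Reasoning

    step : Σ (List (V → Bool)) λ 𝒞 → length 𝒞 ≤ (suc N ^ f) ^ j × Covers 𝒞 H ×
             (∀ {C} → C ∈ 𝒞 → decay s * length (induced C H) + e ≤ decay s * e)
    step = let 𝒞 , count𝒞 , covers , smalls = result in 𝒞 , count𝒞 , covers , λ {C} C∈ → shrinks C (smalls C∈)
      where
      2K≢0 : NonZero (2 * K)
      2K≢0 = m*n≢0 2 K {{_}} {{m*n≢0 4 (2 ^ s) {{_}} {{m^n≢0 2 s}}}}
      constant : 4 * (1 * (2 * K) ^ j) ≤ 4 * p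
      constant = *-monoʳ-≤ 4 (≤-trans (≤-reflexive (*-identityˡ _)) (^-monoʳ-≤ (2 * K) {{2K≢0}} (n≤1+n j)))
      result : Result ((suc N ^ f) ^ j) projections H
      result = containers j κ₀ 1 projections H ≤-refl constant bounded ≤-refl

  -- The target is e ≤ Y / X. Passing to an induced subhypergraph only lowers degrees, so one
  -- function `Δ` serves all of them; the condition needs to hold only for edge counts above the
  -- target.
  module Iterate (X Y : ℕ) (Δ : Pattern V s → ℕ)
    (codegree : ∀ u → 2 ≤ width u → ∀ e → Y < e * X → decay s * N * b ^ (width u ∸ 1) * Δ u ≤ e)
    where

    M : ℕ
    M = (suc N ^ f) ^ j

    M≢0 : NonZero M
    M≢0 = m^n≢0 (suc N ^ f) j {{m^n≢0 (suc N) f}}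

    Outcome : ℕ → List (Vec V s) → Set
    Outcome T H = Σ (List (V → Bool)) λ 𝒞 →
      length 𝒞 ≤ M ^ T × Covers 𝒞 H × (∀ {C} → C ∈ 𝒞 → length (induced C H) * X ≤ Y)

    _∩_ : (V → Bool) → (V → Bool) → V → Bool
    (C ∩ D) v = C v ∧ D v

    induced-∩ : ∀ C D (H : List (Vec V s)) → length (induced (C ∩ D) H) ≤ length (induced D (induced C H))
    induced-∩ C D H = begin
      length (induced (C ∩ D) H)
        ≡⟨ length-filter (contained? (C ∩ D)) H ⟩
      count (contained? (C ∩ D)) H
        ≤⟨ count≤count-filter (contained? (C ∩ D)) (contained? C) (contained? D)
             (λ _ all → VecAll.map (proj₁ ∘ Equivalence.to T-∧) all , VecAll.map (proj₂ ∘ Equivalence.to T-∧) all) H ⟩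
      count (contained? D) (induced C H)
        ≡⟨ sym (length-filter (contained? D) (induced C H)) ⟩
      length (induced D (induced C H)) ∎
      where open ≤-Reasoning

    -- A container `D` of the part induced by `C` may contain edges of `H` that leave `C`; only
    -- `C ∩ D` inherits the sparseness.
    gather : ∀ T H 𝒞₁ → (∀ {C} → C ∈ 𝒞₁ → Outcome T (induced C H)) →
      Σ (List (V → Bool)) λ 𝒞 → length 𝒞 ≤ length 𝒞₁ * M ^ T ×
        (∀ I → Independent I H → ∀ {C} → C ∈ 𝒞₁ → I ⊑ C → ∃ λ D → D ∈ 𝒞 × I ⊑ D) ×
        (∀ {C} → C ∈ 𝒞 → length (induced C H) * X ≤ Y)
    gather T H []        _   = [] , z≤n , (λ _ _ ()) , λ ()
    gather T H (C ∷ 𝒞₁) sub =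
      let 𝒟 , count𝒟 , covers𝒟 , good𝒟 = sub (here refl)
          ℰ , countℰ , coversℰ , goodℰ = gather T H 𝒞₁ (sub ∘ there)
          covers : ∀ I → Independent I H → ∀ {C′} → C′ ∈ C ∷ 𝒞₁ → I ⊑ C′ → ∃ λ D → D ∈ map (C ∩_) 𝒟 ++ ℰ × I ⊑ D
          covers = λ where
            I indep (here refl) I⊑C →
              let D , D∈ , I⊑D = covers𝒟 I (λ e∈ → indep (proj₁ (∈-filter⁻ (contained? C) e∈))) in
              C ∩ D , ++⁺ˡ (∈-map⁺ (C ∩_) D∈) , λ v Iv → Equivalence.from T-∧ (I⊑C v Iv , I⊑D v Iv)
            I indep (there C′∈) I⊑C′ →
              let D , D∈ , I⊑D = coversℰ I indep C′∈ I⊑C′ in D , ++⁺ʳ (map (C ∩_) 𝒟) D∈ , I⊑D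
          good : ∀ {C′} → C′ ∈ map (C ∩_) 𝒟 → length (induced C′ H) * X ≤ Y
          good = λ C′∈ → case-map (∈-map⁻ (C ∩_) C′∈) good𝒟
      in map (C ∩_) 𝒟 ++ ℰ ,
         ≤-trans (≤-reflexive (trans (length-++ (map (C ∩_) 𝒟)) (cong (_+ length ℰ) (length-map (C ∩_) 𝒟))))
                 (+-mono-≤ count𝒟 countℰ) ,
         covers , ([ good , goodℰ ]′ ∘ ++⁻ (map (C ∩_) 𝒟))
      where
      case-map : ∀ {𝒟 C′} → ∃ (λ D → D ∈ 𝒟 × C′ ≡ C ∩ D) →
        (∀ {D} → D ∈ 𝒟 → length (induced D (induced C H)) * X ≤ Y) → length (induced C′ H) * X ≤ Y
      case-map (D , D∈ , refl) good = ≤-trans (*-monoˡ-≤ X (induced-∩ C D H)) (good D∈)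

    trivial : ∀ T H → length H * X ≤ Y → Outcome T H
    trivial T H done = (λ _ → true) ∷ [] , m^n>0 M {{M≢0}} T ,
      (λ I _ → _ , here refl , λ _ _ → tt) ,
      λ { (here refl) → ≤-trans (*-monoˡ-≤ X (≤-trans (≤-reflexive (length-filter (contained? (λ _ → true)) H)) (count≤length _ H))) done }

    fewer : ∀ T x e → decay s * x + e ≤ decay s * e →
      (decay s ∸ 1) ^ suc T * e < decay s ^ suc T → (decay s ∸ 1) ^ T * x < decay s ^ T
    fewer T x e shrink bound = *-cancelˡ-< (decay s) _ _ (begin-strict
      decay s * ((decay s ∸ 1) ^ T * x)
        ≡⟨ r₁ (decay s) ((decay s ∸ 1) ^ T) x ⟩
      (decay s ∸ 1) ^ T * (decay s * x)
        ≤⟨ *-monoʳ-≤ ((decay s ∸ 1) ^ T) (+-cancelʳ-≤ e _ _ (≤-trans shrink (≤-reflexive (split (decay s) {{decay≢0 s}})))) ⟩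
      (decay s ∸ 1) ^ T * ((decay s ∸ 1) * e)
        ≡⟨ r₂ ((decay s ∸ 1) ^ T) (decay s ∸ 1) e ⟩
      (decay s ∸ 1) ^ suc T * e
        <⟨ bound ⟩
      decay s * decay s ^ T ∎)
      where
      open ≤-Reasoning
      r₁ : ∀ a b c → a * (b * c) ≡ b * (a * c)
      r₁ = solve-∀
      r₂ : ∀ a b c → a * (b * c) ≡ b * a * c
      r₂ = solve-∀
      split : ∀ d .{{_ : NonZero d}} → d * e ≡ (d ∸ 1) * e + e
      split (suc d) = +-comm e (d * e)

    -- The potential e (1 - 1 / decay)^T < 1 is preserved as `T` drops by one, because a step loses
    -- at least the proportion 1 / decay of the edges. At `T` = 0 no edge is left, so the target has
    -- been met.
    iterate : ∀ T H → Dec (length H * X ≤ Y) → (∀ u → 2 ≤ width u → count (match? _≟_ u) H ≤ Δ u) →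
      (decay s ∸ 1) ^ T * length H < decay s ^ T → Outcome T H
    iterate T H (yes done) _ _ = trivial T H done
    iterate zero H (no ¬done) _ bound = contradiction (≤-trans (≤-reflexive (cong (_* X) H≡0)) z≤n) ¬done
      where
      H≡0 : length H ≡ 0
      H≡0 = n<1⇒n≡0 (≤-<-trans (≤-reflexive (sym (*-identityˡ (length H)))) bound)
    iterate (suc T) H (no ¬done) degrees bound =
      let 𝒞₁ , count₁ , covers₁ , shrink = OneStep.step H (λ u 2≤u → ≤-trans
            (*-monoʳ-≤ (decay s * N * b ^ (width u ∸ 1)) (degrees u 2≤u)) (codegree u 2≤u (length H) (≰⇒> ¬done)))
          𝒞 , count𝒞 , covers , good = gather T H 𝒞₁ (λ {C} C∈ → iterate T (induced C H) (_ ≤? Y)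
            (λ u 2≤u → ≤-trans (count-filter-≤ (match? _≟_ u) (contained? C) H) (degrees u 2≤u))
            (fewer T (length (induced C H)) (length H) (shrink C∈) bound))
      in 𝒞 , ≤-trans count𝒞 (*-monoˡ-≤ (M ^ T) count₁) ,
         (λ I indep → let C , C∈ , I⊑C = covers₁ I indep in covers I indep C∈ I⊑C) , good

-- Codegrees of the solution hypergraph

⊕-cancelˡ : ∀ {d} (x : Point d) {y z} → x ⊕ y ≡ x ⊕ z → y ≡ z
⊕-cancelˡ []       {[]}    {[]}    _  = refl
⊕-cancelˡ (a ∷ x) {b ∷ y} {c ∷ z} eq with p , q ← ∷-injective eq =
  cong₂ _∷_ (+-cancelˡ-≡ a b c p) (⊕-cancelˡ x q)

⊕-cancelʳ : ∀ {d} (x : Point d) {y z} → y ⊕ x ≡ z ⊕ x → y ≡ z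
⊕-cancelʳ []       {[]}    {[]}    _  = refl
⊕-cancelʳ (a ∷ x) {b ∷ y} {c ∷ z} eq with p , q ← ∷-injective eq =
  cong₂ _∷_ (+-cancelʳ-≡ a b c p) (⊕-cancelʳ x q)

vecs : List A → ∀ n → List (Vec A n)
vecs xs zero    = [] ∷ []
vecs xs (suc n) = cartesianProductWith _∷_ xs (vecs xs n)

∈-vecs : {xs : List A} {n : ℕ} {v : Vec A n} → VecAll.All (_∈ xs) v → v ∈ vecs xs n
∈-vecs []         = here refl
∈-vecs (x∈ ∷ v∈) = ∈-cartesianProductWith⁺ _∷_ x∈ (∈-vecs v∈)

length-product : (c : A → B → U) → ∀ xs ys → length (cartesianProductWith c xs ys) ≡ length xs * length ys
length-product c []       ys = refl
length-product c (x ∷ xs) ys = trans (length-++ (map (c x) ys)) (cong₂ _+_ (length-map (c x) ys) (length-product c xs ys))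

length-vecs : (xs : List A) → ∀ n → length (vecs xs n) ≡ length xs ^ n
length-vecs xs zero    = refl
length-vecs xs (suc n) = trans (length-product _∷_ xs (vecs xs n)) (cong (length xs *_) (length-vecs xs n))

Partial : Set → ℕ → Set
Partial V n = Vec (Maybe V) n

free pinned : ∀ {V n} → Partial V n → ℕ
free []            = 0
free (nothing ∷ q) = suc (free q)
free (just _ ∷ q)  = free q
pinned []            = 0
pinned (nothing ∷ q) = pinned q
pinned (just _ ∷ q)  = suc (pinned q)

free+pinned : ∀ {V n} (q : Partial V n) → free q + pinned q ≡ n
free+pinned []            = refl
free+pinned (nothing ∷ q) = cong suc (free+pinned q)
free+pinned (just _ ∷ q)  = trans (+-suc (free q) (pinned q)) (cong suc (free+pinned q))

pinned-++ : ∀ {V m n} (p : Partial V m) (q : Partial V n) → pinned (p Vec.++ q) ≡ pinned p + pinned q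
pinned-++ []            q = refl
pinned-++ (nothing ∷ p) q = pinned-++ p q
pinned-++ (just _ ∷ p)  q = cong suc (pinned-++ p q)

Extends : ∀ {V n} → Partial V n → Vec V n → Set
Extends []            []      = ⊤
Extends (nothing ∷ q) (x ∷ v) = Extends q v
Extends (just y ∷ q)  (x ∷ v) = x ≡ y × Extends q v

extends-++⁻ : ∀ {V m n} (p : Partial V m) (q : Partial V n) v w →
              Extends (p Vec.++ q) (v Vec.++ w) → Extends p v × Extends q w
extends-++⁻ []            q []      w ext        = tt , ext
extends-++⁻ (nothing ∷ p) q (x ∷ v) w ext        = extends-++⁻ p q v w ext
extends-++⁻ (just y ∷ p)  q (x ∷ v) w (eq , ext) with e₁ , e₂ ← extends-++⁻ p q v w ext = (eq , e₁) , e₂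

complete-row : ∀ {V n} (q : Partial V n) → free q ≡ 0 → Vec V n
complete-row []           _  = []
complete-row (just x ∷ q) eq = x ∷ complete-row q eq

extends-complete : ∀ {V n} (q : Partial V n) eq v → Extends q v → v ≡ complete-row q eq
extends-complete []           eq []      _            = refl
extends-complete (just x ∷ q) eq (y ∷ v) (refl , ext) = cong (x ∷_) (extends-complete q eq v ext)

toPartial : ∀ {V n} → Pattern V n → Partial V n
toPartial (only x)   = just x ∷ replicate _ nothing
toPartial (skip u)   = nothing ∷ toPartial u
toPartial (also x u) = just x ∷ toPartial u

pinned-nothing : ∀ {V} n → pinned {V} (replicate n nothing) ≡ 0
pinned-nothing zero    = refl
pinned-nothing (suc n) = pinned-nothing n

extends-nothing : ∀ {V n} (v : Vec V n) → Extends (replicate n nothing) v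
extends-nothing []      = tt
extends-nothing (_ ∷ v) = extends-nothing v

pinned-toPartial : ∀ {V n} (u : Pattern V n) → pinned (toPartial u) ≡ width u
pinned-toPartial {V} {suc n} (only x) = cong suc (pinned-nothing {V} n)
pinned-toPartial (skip u)   = pinned-toPartial u
pinned-toPartial (also x u) = cong suc (pinned-toPartial u)

match-extends : ∀ {V n} (u : Pattern V n) v → Match u v → Extends (toPartial u) v
match-extends (only x)   (y ∷ v) eq      = eq , extends-nothing v
match-extends (skip u)   (y ∷ v) m       = match-extends u v m
match-extends (also x u) (y ∷ v) (eq , m) = eq , match-extends u v m

Grid : Set → ℕ → ℕ → Set
Grid V k h = Vec (Partial V h) k

-- `slack` counts the free choices once every row sum is prescribed: a row with free entries loses
-- one of them, and truncated subtraction leaves 0 for a full row.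
slack fullRows : ∀ {V k h} → Grid V k h → ℕ
slack []       = 0
slack (q ∷ qs) = (free q ∸ 1) + slack qs
fullRows []       = 0
fullRows (q ∷ qs) with free q
... | zero  = suc (fullRows qs)
... | suc _ = fullRows qs

-- Row by row (free ∸ 1) + 1 + pinned is h, except that truncation makes it h + 1 in a full row.
slack-fullRows : ∀ {V k h} (qs : Grid V k h) → slack qs + k + pinned (concat qs) ≡ k * h + fullRows qs
slack-fullRows []       = refl
slack-fullRows {k = suc k} {h} (q ∷ qs) rewrite pinned-++ q (concat qs) with free q | free+pinned q
... | zero  | eq = trans (r (slack qs) k (pinned q) (pinned (concat qs)))
    (trans (cong (λ x → suc (pinned q + x)) (slack-fullRows qs))
           (trans (r′ (pinned q) (k * h) (fullRows qs)) (cong (λ x → x + k * h + suc (fullRows qs)) eq)))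
  where
  r : ∀ s k p p′ → s + suc k + (p + p′) ≡ suc (p + (s + k + p′))
  r = solve-∀
  r′ : ∀ p kh f → suc (p + (kh + f)) ≡ p + kh + suc f
  r′ = solve-∀
... | suc m | eq = trans (r m (slack qs) k (pinned q) (pinned (concat qs)))
    (trans (cong₂ _+_ eq (slack-fullRows qs)) (sym (+-assoc h (k * h) (fullRows qs))))
  where
  r : ∀ m s k p p′ → m + s + suc k + (p + p′) ≡ suc (m + p) + (s + k + p′)
  r = solve-∀

fullRows-pinned : ∀ {V k h} (qs : Grid V k h) → fullRows qs * h ≤ pinned (concat qs)
fullRows-pinned []       = z≤n
fullRows-pinned {h = h} (q ∷ qs) rewrite pinned-++ q (concat qs) with free q | free+pinned q
... | zero  | eq = +-mono-≤ (≤-reflexive (sym eq)) (fullRows-pinned qs)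
... | suc m | _    = ≤-trans (fullRows-pinned qs) (m≤n+m _ (pinned q))

full-row? : ∀ {V k h} (qs : Grid V k h) → (∃ λ ℓ → free (lookup qs ℓ) ≡ 0 × 1 ≤ fullRows qs) ⊎ fullRows qs ≡ 0
full-row? []       = inj₂ refl
full-row? (q ∷ qs) with free q in eq
... | zero  = inj₁ (zero , eq , s≤s z≤n)
... | suc _ with full-row? qs
...   | inj₁ (ℓ , eqℓ , le) = inj₁ (suc ℓ , eqℓ , le)
...   | inj₂ none           = inj₂ none

first-row-free : ∀ {V k h} (q : Partial V h) (qs : Grid V k h) → fullRows (q ∷ qs) ≡ 0 →
                 free q + slack qs ≡ suc (slack (q ∷ qs))
first-row-free q qs none with free q
... | suc _ = refl

module Codegree {a d : ℕ} (r : ℕ) (1≤r : 1 ≤ r) (pt : Fin a → Point d) (pt-injective : ∀ {i j} → pt i ≡ pt j → i ≡ j) where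

  Vertex : Set
  Vertex = Fin a × Fin r

  _≟_ : DecidableEquality Vertex
  _≟_ = ≡-dec Fin._≟_ Fin._≟_

  vertices : List Vertex
  vertices = cartesianProduct (allFin a) (allFin r)

  ∈-vertices : ∀ v → v ∈ vertices
  ∈-vertices (i , c) = ∈-cartesianProduct⁺ (∈-allFin i) (∈-allFin c)

  length-allFin : ∀ n → length (allFin n) ≡ n
  length-allFin n = length-tabulate {n = n} id

  length-vertices : length vertices ≡ a * r
  length-vertices = trans (length-product _,_ (allFin a) (allFin r)) (cong₂ _*_ (length-allFin a) (length-allFin r))

  private
    N : ℕ
    N = length vertices

  rowSum : ∀ {h} → Vec Vertex h → Point d
  rowSum []      = replicate d 0
  rowSum (v ∷ R) = pt (proj₁ v) ⊕ rowSum R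

  _≟ᴾ_ : DecidableEquality (Point d)
  _≟ᴾ_ = vec-≟ Data.Nat.Properties._≟_

  extends? : ∀ {n} (q : Partial Vertex n) → Decidable (Extends q)
  extends? []            []      = yes tt
  extends? (nothing ∷ q) (x ∷ v) = extends? q v
  extends? (just y ∷ q)  (x ∷ v) = x ≟ y ×-dec extends? q v

  count-≡ : ∀ y → count (_≟ y) vertices ≤ 1
  count-≡ y = count-subsingleton (_≟ y) (λ p q → trans p (sym q)) (cartesianProduct⁺ (allFin⁺ a) (allFin⁺ r))

  -- Cancellation determines the point, and its `r` colours remain. `φ` stands for the addition of
  -- pinned vertices that precede the vertex in its row.
  count-vertex-sum : (φ : Point d → Point d) → (∀ {x y} → φ x ≡ φ y → x ≡ y) → ∀ w σ →
    count (λ v → φ (pt (proj₁ v) ⊕ w) ≟ᴾ σ) vertices ≤ r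
  count-vertex-sum φ φ-injective w σ = begin
    count (λ v → φ (pt (proj₁ v) ⊕ w) ≟ᴾ σ) vertices
      ≤⟨ count-product _,_ (λ i → φ (pt i ⊕ w) ≟ᴾ σ) (λ _ → yes tt) (λ v → φ (pt (proj₁ v) ⊕ w) ≟ᴾ σ)
           (λ _ _ eq → eq , tt) (allFin a) (allFin r) ⟩
    count (λ i → φ (pt i ⊕ w) ≟ᴾ σ) (allFin a) * count (λ _ → yes tt) (allFin r)
      ≤⟨ *-mono-≤ (count-subsingleton (λ i → φ (pt i ⊕ w) ≟ᴾ σ)
            (λ p q → pt-injective (⊕-cancelʳ w (φ-injective (trans p (sym q))))) (allFin⁺ a))
          (≤-trans (count≤length (λ _ → yes tt) (allFin r)) (≤-reflexive (length-allFin r))) ⟩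
    1 * r ≡⟨ *-identityˡ r ⟩
    r ∎
    where open ≤-Reasoning

  count-extends : ∀ {n} (q : Partial Vertex n) → count (extends? q) (vecs vertices n) ≤ N ^ free q
  count-extends []            = ≤-refl
  count-extends (nothing ∷ q) = ≤-trans
    (count-product _∷_ (λ _ → yes tt) (extends? q) (extends? (nothing ∷ q)) (λ _ _ ext → tt , ext) vertices _)
    (*-mono-≤ (count≤length (λ _ → yes tt) vertices) (count-extends q))
  count-extends (just y ∷ q)  = ≤-trans
    (count-product _∷_ (_≟ y) (extends? q) (extends? (just y ∷ q)) (λ _ _ → id) vertices _)
    (≤-trans (*-mono-≤ (count-≡ y) (count-extends q)) (≤-reflexive (*-identityˡ _)))

  -- The first free vertex is determined, up to its colour, by the rest of the row and the sum.
  count-extends-sum : ∀ {n} (q : Partial Vertex n) m → free q ≡ suc m →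
    (φ : Point d → Point d) → (∀ {x y} → φ x ≡ φ y → x ≡ y) → ∀ σ →
    count (λ R → extends? q R ×-dec φ (rowSum R) ≟ᴾ σ) (vecs vertices n) ≤ N ^ m * r
  count-extends-sum (nothing ∷ q) m refl φ φ-injective σ = ≤-trans
    (count-fibre _∷_ (extends? q) (λ R → extends? (nothing ∷ q) R ×-dec φ (rowSum R) ≟ᴾ σ)
      (λ R v → φ (pt (proj₁ v) ⊕ rowSum R) ≟ᴾ σ) (λ _ _ → id) vertices _ r
      (λ R → count-vertex-sum φ φ-injective (rowSum R) σ))
    (*-monoˡ-≤ r (count-extends q))
  count-extends-sum (just y ∷ q) m eq φ φ-injective σ = ≤-trans
    (count-product _∷_ (_≟ y) (λ R → extends? q R ×-dec φ (pt (proj₁ y) ⊕ rowSum R) ≟ᴾ σ)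
      (λ R → extends? (just y ∷ q) R ×-dec φ (rowSum R) ≟ᴾ σ)
      (λ { _ _ ((refl , ext) , sum) → refl , ext , sum }) vertices _)
    (≤-trans (*-mono-≤ (count-≡ y)
        (count-extends-sum q m eq (λ x → φ (pt (proj₁ y) ⊕ x)) (⊕-cancelˡ (pt (proj₁ y)) ∘ φ-injective) σ))
      (≤-reflexive (*-identityˡ _)))

  count-row : ∀ {n} (q : Partial Vertex n) σ →
    count (λ R → extends? q R ×-dec rowSum R ≟ᴾ σ) (vecs vertices n) ≤ N ^ (free q ∸ 1) * r
  count-row {n} q σ = by-free (free q) refl
    where
    by-free : ∀ m → free q ≡ m → count (λ R → extends? q R ×-dec rowSum R ≟ᴾ σ) (vecs vertices n) ≤ N ^ (m ∸ 1) * r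
    by-free (suc m) eq = count-extends-sum q m eq id id σ
    -- A full row has at most one candidate, and `1 ≤ r` brings it under the common bound, in which
    -- 0 ∸ 1 is 0.
    by-free zero    eq = ≤-trans (count-mono-≤ _ (extends? q) (λ _ → proj₁) (vecs vertices n))
      (≤-trans (count-extends q) (≤-trans (≤-reflexive (cong (N ^_) eq)) (≤-trans 1≤r (≤-reflexive (sym (*-identityˡ r))))))

  RowsAt : ∀ {k h} → Point d → Grid Vertex k h → Vec (Vec Vertex h) k → Set
  RowsAt σ []       []       = ⊤
  RowsAt σ (q ∷ qs) (R ∷ Rs) = (Extends q R × rowSum R ≡ σ) × RowsAt σ qs Rs

  rowsAt? : ∀ {k h} σ (qs : Grid Vertex k h) → Decidable (RowsAt σ qs)
  rowsAt? σ []       []       = yes tt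
  rowsAt? σ (q ∷ qs) (R ∷ Rs) = (extends? q R ×-dec rowSum R ≟ᴾ σ) ×-dec rowsAt? σ qs Rs

  rowsAt : ∀ {k h} σ (qs : Grid Vertex k h) Rs → Extends (concat qs) (concat Rs) →
           (∀ ℓ → rowSum (lookup Rs ℓ) ≡ σ) → RowsAt σ qs Rs
  rowsAt σ []       []       _   _    = tt
  rowsAt σ (q ∷ qs) (R ∷ Rs) ext sums with e₁ , e₂ ← extends-++⁻ q (concat qs) R (concat Rs) ext =
    (e₁ , sums zero) , rowsAt σ qs Rs e₂ (sums ∘ suc)

  extends-row : ∀ {k h} (qs : Grid Vertex k h) Rs → Extends (concat qs) (concat Rs) →
                ∀ ℓ → Extends (lookup qs ℓ) (lookup Rs ℓ)
  extends-row (q ∷ qs) (R ∷ Rs) ext ℓ with e₁ , e₂ ← extends-++⁻ q (concat qs) R (concat Rs) ext | ℓ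
  ... | zero   = e₁
  ... | suc ℓ′ = extends-row qs Rs e₂ ℓ′

  grids : ∀ k h → List (Vec (Vec Vertex h) k)
  grids k h = vecs (vecs vertices h) k

  -- Once the common sum is prescribed, the rows are independent of each other and their counts
  -- multiply.
  count-rowsAt : ∀ {k h} σ (qs : Grid Vertex k h) → count (rowsAt? σ qs) (grids k h) ≤ r ^ k * N ^ slack qs
  count-rowsAt σ []       = ≤-refl
  count-rowsAt {suc k} {h} σ (q ∷ qs) = begin
    count (rowsAt? σ (q ∷ qs)) (grids (suc k) h)
      ≤⟨ count-product _∷_ (λ R → extends? q R ×-dec rowSum R ≟ᴾ σ) (rowsAt? σ qs) (rowsAt? σ (q ∷ qs))
           (λ _ _ → id) (vecs vertices h) (grids k h) ⟩
    count (λ R → extends? q R ×-dec rowSum R ≟ᴾ σ) (vecs vertices h) * count (rowsAt? σ qs) (grids k h)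
      ≤⟨ *-mono-≤ (count-row q σ) (count-rowsAt σ qs) ⟩
    N ^ (free q ∸ 1) * r * (r ^ k * N ^ slack qs)
      ≡⟨ regroup (N ^ (free q ∸ 1)) r (r ^ k) (N ^ slack qs) ⟩
    r * r ^ k * (N ^ (free q ∸ 1) * N ^ slack qs)
      ≡⟨ cong (r * r ^ k *_) (sym (^-distribˡ-+-* N (free q ∸ 1) (slack qs))) ⟩
    r ^ suc k * N ^ slack (q ∷ qs) ∎
    where
    open ≤-Reasoning
    regroup : ∀ x r y z → x * r * (y * z) ≡ r * y * (x * z)
    regroup = solve-∀

  module _ {k h : ℕ} {Sol : Pred (Vec (Vec Vertex h) (suc k)) 0ℓ} (sol? : Decidable Sol)
           (sums-equal : ∀ Rs → Sol Rs → ∀ ℓ ℓ′ → rowSum (lookup Rs ℓ) ≡ rowSum (lookup Rs ℓ′)) where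

    private
      s : ℕ
      s = suc k * h

      -- A full row fixes the common sum; without one, the first row is chosen freely.
      count-grid : (qs : Grid Vertex (suc k) h) (P? : Decidable (λ Rs → Sol Rs × Extends (concat qs) (concat Rs))) →
        (1 ≤ fullRows qs × count P? (grids (suc k) h) ≤ r ^ suc k * N ^ slack qs) ⊎
        (fullRows qs ≡ 0 × count P? (grids (suc k) h) ≤ r ^ suc k * N ^ suc (slack qs))
      count-grid qs P? with full-row? qs
      ... | inj₁ (ℓ , full , some) = inj₁ (some , ≤-trans
              (count-mono-≤ P? (rowsAt? σ qs) at-σ (grids (suc k) h)) (count-rowsAt σ qs))
        where
        σ : Point d
        σ = rowSum (complete-row (lookup qs ℓ) full)
        at-σ : ∀ Rs → Sol Rs × Extends (concat qs) (concat Rs) → RowsAt σ qs Rs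
        at-σ Rs (sol , ext) = rowsAt σ qs Rs ext λ ℓ′ → trans (sums-equal Rs sol ℓ′ ℓ)
          (cong rowSum (extends-complete (lookup qs ℓ) full (lookup Rs ℓ) (extends-row qs Rs ext ℓ)))
      count-grid (q ∷ qs) P? | inj₂ none = inj₂ (none , (begin
        count P? (grids (suc k) h)
          ≡⟨ sumOver-product (λ Rs → indicator (P? Rs)) _∷_ (vecs vertices h) (grids k h) ⟩
        sumOver (λ R → sumOver (λ Rs → indicator (P? (R ∷ Rs))) (grids k h)) (vecs vertices h)
          ≤⟨ sumOver-mono-≤ first (vecs vertices h) ⟩
        sumOver (λ R → indicator (extends? q R) * (r ^ k * N ^ slack qs)) (vecs vertices h)
          ≡⟨ sumOver-*ʳ (λ R → indicator (extends? q R)) _ (vecs vertices h) ⟩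
        count (extends? q) (vecs vertices h) * (r ^ k * N ^ slack qs)
          ≤⟨ *-monoˡ-≤ (r ^ k * N ^ slack qs) (count-extends q) ⟩
        N ^ free q * (r ^ k * N ^ slack qs)
          ≡⟨ regroup (N ^ free q) (r ^ k) (N ^ slack qs) ⟩
        r ^ k * (N ^ free q * N ^ slack qs)
          ≡⟨ cong (r ^ k *_) (sym (^-distribˡ-+-* N (free q) (slack qs))) ⟩
        r ^ k * N ^ (free q + slack qs)
          ≡⟨ cong (λ x → r ^ k * N ^ x) (first-row-free q qs none) ⟩
        r ^ k * N ^ suc (slack (q ∷ qs))
          ≤⟨ *-monoˡ-≤ (N ^ suc (slack (q ∷ qs))) (m≤n*m (r ^ k) r {{>-nonZero 1≤r}}) ⟩
        r ^ suc k * N ^ suc (slack (q ∷ qs)) ∎))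
        where
        open ≤-Reasoning
        regroup : ∀ x y z → x * (y * z) ≡ y * (x * z)
        regroup = solve-∀
        first : ∀ R → sumOver (λ Rs → indicator (P? (R ∷ Rs))) (grids k h) ≤ indicator (extends? q R) * (r ^ k * N ^ slack qs)
        first R = begin
          sumOver (λ Rs → indicator (P? (R ∷ Rs))) (grids k h)
            ≤⟨ sumOver-mono-≤ (λ Rs → indicator-≤-* (P? (R ∷ Rs)) (extends? q R) (rowsAt? (rowSum R) qs Rs)
                 (λ (sol , ext) → let e₁ , e₂ = extends-++⁻ q (concat qs) R (concat Rs) ext in
                   e₁ , rowsAt (rowSum R) qs Rs e₂ (λ ℓ → sums-equal (R ∷ Rs) sol (suc ℓ) zero))) (grids k h) ⟩
          sumOver (λ Rs → indicator (extends? q R) * indicator (rowsAt? (rowSum R) qs Rs)) (grids k h)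
            ≡⟨ sumOver-*ˡ (indicator (extends? q R)) _ (grids k h) ⟩
          indicator (extends? q R) * count (rowsAt? (rowSum R) qs) (grids k h)
            ≤⟨ *-monoʳ-≤ (indicator (extends? q R)) (count-rowsAt (rowSum R) qs) ⟩
          indicator (extends? q R) * (r ^ k * N ^ slack qs) ∎

    solutions : List (Vec Vertex (suc k * h))
    solutions = map concat (filter sol? (grids (suc k) h))

    -- a is the number of rows completely fixed by u, or 1 if there is none.
    codegree-count : ∀ u → ∃₂ λ x a → count (match? _≟_ u) solutions ≤ r ^ suc k * N ^ x ×
      x + suc k + width u ≡ s + a × 1 ≤ a × (a ≡ 1 ⊎ a * h ≤ width u)
    codegree-count u with qs , u≡ ← Vec.group (suc k) h (toPartial u) =
      finish (count-grid qs P?)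
      where
      P? : Decidable (λ Rs → Sol Rs × Extends (concat qs) (concat Rs))
      P? Rs = sol? Rs ×-dec extends? (concat qs) (concat Rs)
      match≤ : count (match? _≟_ u) solutions ≤ count P? (grids (suc k) h)
      match≤ = count-map-filter concat sol? (match? _≟_ u) P?
        (λ Rs sol m → sol , subst (λ q → Extends q (concat Rs)) u≡ (match-extends u (concat Rs) m)) (grids (suc k) h)
      width≡ : pinned (concat qs) ≡ width u
      width≡ = trans (cong pinned (sym u≡)) (pinned-toPartial u)
      balance : slack qs + suc k + width u ≡ s + fullRows qs
      balance = trans (cong (slack qs + suc k +_) (sym width≡)) (slack-fullRows qs)
      finish : (1 ≤ fullRows qs × count P? (grids (suc k) h) ≤ r ^ suc k * N ^ slack qs) ⊎
               (fullRows qs ≡ 0 × count P? (grids (suc k) h) ≤ r ^ suc k * N ^ suc (slack qs)) →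
               ∃₂ λ x a → count (match? _≟_ u) solutions ≤ r ^ suc k * N ^ x ×
                 x + suc k + width u ≡ s + a × 1 ≤ a × (a ≡ 1 ⊎ a * h ≤ width u)
      finish (inj₁ (some , bound)) = slack qs , fullRows qs , ≤-trans match≤ bound , balance , some ,
        inj₂ (≤-trans (fullRows-pinned qs) (≤-reflexive width≡))
      finish (inj₂ (none , bound)) = suc (slack qs) , 1 , ≤-trans match≤ bound ,
        trans (cong suc balance) (trans (cong (λ a → suc (s + a)) none) (sym (+-suc s 0))) , ≤-refl , inj₁ refl

-- Templates and solutions

lookup-injective : {xs : List A} → Unique xs → ∀ {i j} → lookupᴸ xs i ≡ lookupᴸ xs j → i ≡ j
lookup-injective (_ ∷ _)      {zero}  {zero}  _  = refl
lookup-injective {xs = _ ∷ xs} (x∉ ∷ _) {zero}  {suc j} eq = contradiction eq (All.lookup x∉ (∈-lookup j))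
lookup-injective {xs = _ ∷ xs} (x∉ ∷ _) {suc i} {zero}  eq = contradiction (sym eq) (All.lookup x∉ (∈-lookup i))
lookup-injective (_ ∷ xs!)    {suc i} {suc j} eq = cong suc (lookup-injective xs! eq)

concat-injective : ∀ {m n} (xss yss : Vec (Vec A m) n) → concat xss ≡ concat yss → xss ≡ yss
concat-injective []         []         _  = refl
concat-injective (xs ∷ xss) (ys ∷ yss) eq with p , q ← ++-injective xs ys eq =
  cong₂ _∷_ p (concat-injective xss yss q)

vec-ext : ∀ {n} (xs ys : Vec A n) → (∀ i → lookup xs i ≡ lookup ys i) → xs ≡ ys
vec-ext xs ys eq = trans (sym (tabulate∘lookup xs)) (trans (tabulate-cong eq) (tabulate∘lookup ys))

∣p∣≡0⇒p≡⊥ : ∀ {n} (p : Subset n) → ∣ p ∣ ≡ 0 → p ≡ ⊥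
∣p∣≡0⇒p≡⊥ []            _  = refl
∣p∣≡0⇒p≡⊥ (false ∷ p) eq = cong (false ∷_) (∣p∣≡0⇒p≡⊥ p eq)

∣p∣≡1⇒singleton : ∀ {n} (p : Subset n) → ∣ p ∣ ≡ 1 → ∃ λ c → p ≡ ⁅ c ⁆
∣p∣≡1⇒singleton (false ∷ p) eq with c , p≡ ← ∣p∣≡1⇒singleton p eq = suc c , cong (false ∷_) p≡
∣p∣≡1⇒singleton (true ∷ p)  eq = zero , cong (true ∷_) (∣p∣≡0⇒p≡⊥ p (suc-injective eq))

⁅⁆-injective : ∀ {n} {c c′ : Fin n} → ⁅ c ⁆ ≡ ⁅ c′ ⁆ → c ≡ c′
⁅⁆-injective {c = c} {c′} eq = x∈⁅y⁆⇒x≡y c′ (subst (c ∈ˢ_) eq (x∈⁅x⁆ c))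

∈ˢ⇒T : ∀ {n} {p : Subset n} {c} → c ∈ˢ p → T (lookup p c)
∈ˢ⇒T = Equivalence.from T-≡ ∘ []=⇒lookup

T⇒∈ˢ : ∀ {n} (p : Subset n) c → T (lookup p c) → c ∈ˢ p
T⇒∈ˢ p c = lookup⇒[]= c p ∘ Equivalence.to T-≡

module Templates {n d : ℕ} (A : SubsetOfBox n d) (k h r : ℕ) (1≤r : 1 ≤ r) where

  open Codegree r 1≤r (point A) (lookup-injective (SubsetOfBox.unique A)) public

  Cells : Set
  Cells = Vec (Vec Vertex h) k

  cell : Cells → Fin k → Fin h → Vertex
  cell Rs ℓ i = lookup (lookup Rs ℓ) i

  SumsEqual PointsDistinct ColoursDistinct Solution : Pred Cells _
  SumsEqual       Rs = ∀ ℓ ℓ′ → rowSum (lookup Rs ℓ) ≡ rowSum (lookup Rs ℓ′)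
  PointsDistinct  Rs = ∀ ℓ i ℓ′ i′ → proj₁ (cell Rs ℓ i) ≡ proj₁ (cell Rs ℓ′ i′) → ℓ ≡ ℓ′ × i ≡ i′
  ColoursDistinct Rs = ∀ ℓ i ℓ′ i′ → proj₂ (cell Rs ℓ i) ≡ proj₂ (cell Rs ℓ′ i′) → ℓ ≡ ℓ′ × i ≡ i′
  Solution        Rs = SumsEqual Rs × PointsDistinct Rs × ColoursDistinct Rs

  distinct? : ∀ {m} (f : Vertex → Fin m) Rs →
    Dec (∀ ℓ i ℓ′ i′ → f (cell Rs ℓ i) ≡ f (cell Rs ℓ′ i′) → ℓ ≡ ℓ′ × i ≡ i′)
  distinct? f Rs = Fin.all? λ ℓ → Fin.all? λ i → Fin.all? λ ℓ′ → Fin.all? λ i′ →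
    (f (cell Rs ℓ i) Fin.≟ f (cell Rs ℓ′ i′)) →-dec (ℓ Fin.≟ ℓ′ ×-dec i Fin.≟ i′)

  solution? : Decidable Solution
  solution? Rs = (Fin.all? λ ℓ → Fin.all? λ ℓ′ → rowSum (lookup Rs ℓ) ≟ᴾ rowSum (lookup Rs ℓ′))
    ×-dec distinct? proj₁ Rs ×-dec distinct? proj₂ Rs

  edges : List (Vec Vertex (k * h))
  edges = map concat (filter solution? (grids k h))

  ∈-edges : ∀ Rs → Solution Rs → concat Rs ∈ edges
  ∈-edges Rs sol = ∈-map⁺ concat (∈-filter⁺ solution? (∈-vecs (VecAll.universal (λ R → ∈-vecs (VecAll.universal ∈-vertices R)) Rs)) sol)

  rowSum≡sumPts : ∀ {m} (R : Vec Vertex m) → rowSum R ≡ sumPts m (λ i → point A (proj₁ (lookup R i)))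
  rowSum≡sumPts []      = refl
  rowSum≡sumPts (v ∷ R) = cong (point A (proj₁ v) ⊕_) (rowSum≡sumPts R)

  member : Template r A → Vertex → Bool
  member P (y , c) = lookup (lookup P y) c

  toTemplate : (Vertex → Bool) → Template r A
  toTemplate C = tabulate λ y → tabulate λ c → C (y , c)

  member-toTemplate : ∀ C v → member (toTemplate C) v ≡ C v
  member-toTemplate C (y , c) = trans
    (cong (λ p → lookup p c) (lookup∘tabulate (λ y → tabulate λ c → C (y , c)) y)) (lookup∘tabulate (λ c → C (y , c)) c)

  subtemplate : ∀ P Q → Subtemplate {A = A} P Q → member P ⊑ member Q
  subtemplate P Q P⊆Q (y , c) t = ∈ˢ⇒T (P⊆Q y (T⇒∈ˢ (lookup P y) c t))

  ⊑⇒subtemplate : ∀ P C → member P ⊑ C → Subtemplate {A = A} P (toTemplate C)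
  ⊑⇒subtemplate P C P⊑C y {c} c∈ = T⇒∈ˢ (lookup (toTemplate C) y) c
    (subst T (sym (member-toTemplate C (y , c))) (P⊑C (y , c) (∈ˢ⇒T c∈)))

  -- A tuple of coloured points determines such a template, while reordering the tuple may leave the
  -- template unchanged.
  Represents : Template r A → Cells → Set
  Represents Q Rs = (∀ ℓ i → lookup Q (proj₁ (cell Rs ℓ i)) ≡ ⁅ proj₂ (cell Rs ℓ i) ⁆) ×
                    (∀ y → (∀ ℓ i → y ≢ proj₁ (cell Rs ℓ i)) → lookup Q y ≡ ⊥)

  occurs? : ∀ Rs y → Dec (∃₂ λ ℓ i → y ≡ proj₁ (cell Rs ℓ i))
  occurs? Rs y = Fin.any? λ ℓ → Fin.any? λ i → y Fin.≟ proj₁ (cell Rs ℓ i)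

  represents-unique : ∀ {Q Q′} Rs → Represents Q Rs → Represents Q′ Rs → Q ≡ Q′
  represents-unique {Q} {Q′} Rs (at , off) (at′ , off′) = vec-ext Q Q′ agree
    where
    agree : ∀ y → lookup Q y ≡ lookup Q′ y
    agree y with occurs? Rs y
    ... | yes (ℓ , i , refl) = trans (at ℓ i) (sym (at′ ℓ i))
    ... | no absent = trans (off y none) (sym (off′ y none))
      where
      none : ∀ ℓ i → y ≢ proj₁ (cell Rs ℓ i)
      none ℓ i eq = absent (ℓ , i , eq)

  colourTemplate : Cells → Template r A
  colourTemplate Rs = tabulate palette-at
    module ColourTemplate where
    palette-at : Fin (size A) → Subset r
    palette-at y with occurs? Rs y
    ... | yes (ℓ , i , _) = ⁅ proj₂ (cell Rs ℓ i) ⁆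
    ... | no  _           = ⊥

  represents-colourTemplate : ∀ Rs → PointsDistinct Rs → Represents (colourTemplate Rs) Rs
  represents-colourTemplate Rs distinct = at , off
    where
    open ColourTemplate Rs
    palette-cell : ∀ ℓ i → palette-at (proj₁ (cell Rs ℓ i)) ≡ ⁅ proj₂ (cell Rs ℓ i) ⁆
    palette-cell ℓ i with occurs? Rs (proj₁ (cell Rs ℓ i))
    ... | no absent = contradiction (ℓ , i , refl) absent
    -- Distinctness of the points forces the occurrence found by the search to be the given one.
    ... | yes (ℓ′ , i′ , eq) with refl , refl ← distinct ℓ i ℓ′ i′ eq = refl
    palette-off : ∀ y → (∀ ℓ i → y ≢ proj₁ (cell Rs ℓ i)) → palette-at y ≡ ⊥
    palette-off y none with occurs? Rs y
    ... | no _             = refl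
    ... | yes (ℓ , i , eq) = contradiction eq (none ℓ i)
    at : ∀ ℓ i → lookup (colourTemplate Rs) (proj₁ (cell Rs ℓ i)) ≡ ⁅ proj₂ (cell Rs ℓ i) ⁆
    at ℓ i = trans (lookup∘tabulate palette-at _) (palette-cell ℓ i)
    off : ∀ y → (∀ ℓ i → y ≢ proj₁ (cell Rs ℓ i)) → lookup (colourTemplate Rs) y ≡ ⊥
    off y none = trans (lookup∘tabulate palette-at y) (palette-off y none)

  represents-rainbow : ∀ Q Rs → Solution Rs → Represents Q Rs → RainbowSolution k h {A = A} Q
  represents-rainbow Q Rs (sums , _ , colours) (at , off) =
    (λ ℓ i → proj₁ (cell Rs ℓ i)) ,
    (λ ℓ ℓ′ → trans (sym (rowSum≡sumPts (lookup Rs ℓ))) (trans (sums ℓ ℓ′) (rowSum≡sumPts (lookup Rs ℓ′)))) ,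
    (λ ℓ i → trans (cong ∣_∣ (at ℓ i)) (∣⁅x⁆∣≡1 (proj₂ (cell Rs ℓ i)))) ,
    off ,
    (λ ℓ i ℓ′ i′ ne eq → ne (colours ℓ i ℓ′ i′ (⁅⁆-injective (trans (sym (at ℓ i)) (trans eq (at ℓ′ i′))))))

  represents-below : ∀ Q P Rs → Represents Q Rs → (∀ ℓ i → T (member P (cell Rs ℓ i))) → Subtemplate {A = A} Q P
  represents-below Q P Rs (at , off) inside-P y {c} c∈ with occurs? Rs y
  ... | no absent = contradiction (subst (c ∈ˢ_) (off y (λ ℓ i eq → absent (ℓ , i , eq))) c∈) ∉⊥
  ... | yes (ℓ , i , refl) with refl ← x∈⁅y⁆⇒x≡y _ (subst (c ∈ˢ_) (at ℓ i) c∈) =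
    T⇒∈ˢ (lookup P y) c (inside-P ℓ i)

  -- The template that an edge inside `P` represents would be a rainbow solution below `P`.
  noRainbow⇒independent : ∀ P → NoRainbow k h {A = A} P → Independent (member P) edges
  noRainbow⇒independent P none e∈ all with ∈-map⁻ concat e∈
  ... | Rs , Rs∈ , refl = none (colourTemplate Rs)
      (represents-below (colourTemplate Rs) P Rs rep (λ ℓ i → lookup⁺ (lookup⁺ (concat⁻ Rs all) ℓ) i))
      (represents-rainbow (colourTemplate Rs) Rs sol rep)
    where
    sol : Solution Rs
    sol = proj₂ (∈-filter⁻ solution? {xs = grids k h} Rs∈)
    rep : Represents (colourTemplate Rs) Rs
    rep = represents-colourTemplate Rs (proj₁ (proj₂ sol))

  -- Distinct palettes yield both distinctness conditions: equal points have equal palettes, and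
  -- equal colours give equal singletons.
  rainbow⇒represents : ∀ Q → RainbowSolution k h {A = A} Q → ∃ λ Rs → Solution Rs × Represents Q Rs
  rainbow⇒represents Q (x , sums , single , off , distinct) = Rs , (sums′ , points , colours) , at , off′
    where
    c : Fin k → Fin h → Fin r
    c ℓ i = proj₁ (∣p∣≡1⇒singleton (lookup Q (x ℓ i)) (single ℓ i))
    Rs : Cells
    Rs = tabulate λ ℓ → tabulate λ i → x ℓ i , c ℓ i
    row≡ : ∀ ℓ → lookup Rs ℓ ≡ tabulate λ i → x ℓ i , c ℓ i
    row≡ ℓ = lookup∘tabulate (λ ℓ → tabulate λ i → x ℓ i , c ℓ i) ℓ
    cell≡ : ∀ ℓ i → cell Rs ℓ i ≡ (x ℓ i , c ℓ i)
    cell≡ ℓ i = trans (cong (λ R → lookup R i) (row≡ ℓ)) (lookup∘tabulate (λ i → x ℓ i , c ℓ i) i)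
    palette≡ : ∀ ℓ i → lookup Q (x ℓ i) ≡ ⁅ c ℓ i ⁆
    palette≡ ℓ i = proj₂ (∣p∣≡1⇒singleton (lookup Q (x ℓ i)) (single ℓ i))
    at : ∀ ℓ i → lookup Q (proj₁ (cell Rs ℓ i)) ≡ ⁅ proj₂ (cell Rs ℓ i) ⁆
    at ℓ i = subst (λ v → lookup Q (proj₁ v) ≡ ⁅ proj₂ v ⁆) (sym (cell≡ ℓ i)) (palette≡ ℓ i)
    off′ : ∀ y → (∀ ℓ i → y ≢ proj₁ (cell Rs ℓ i)) → lookup Q y ≡ ⊥
    off′ y none = off y (λ ℓ i eq → none ℓ i (trans eq (sym (cong proj₁ (cell≡ ℓ i)))))
    same-palette : ∀ ℓ i ℓ′ i′ → lookup Q (proj₁ (cell Rs ℓ i)) ≡ lookup Q (proj₁ (cell Rs ℓ′ i′)) → ℓ ≡ ℓ′ × i ≡ i′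
    same-palette ℓ i ℓ′ i′ eq with ℓ Fin.≟ ℓ′ ×-dec i Fin.≟ i′
    ... | yes same = same
    ... | no  ne   = contradiction
      (trans (cong (lookup Q ∘ proj₁) (sym (cell≡ ℓ i))) (trans eq (cong (lookup Q ∘ proj₁) (cell≡ ℓ′ i′))))
      (distinct ℓ i ℓ′ i′ ne)
    points : PointsDistinct Rs
    points ℓ i ℓ′ i′ eq = same-palette ℓ i ℓ′ i′ (cong (lookup Q) eq)
    colours : ColoursDistinct Rs
    colours ℓ i ℓ′ i′ eq = same-palette ℓ i ℓ′ i′ (trans (at ℓ i) (trans (cong ⁅_⁆ eq) (sym (at ℓ′ i′))))
    sumPts-cong : ∀ m {f g : Fin m → Point d} → (∀ i → f i ≡ g i) → sumPts m f ≡ sumPts m g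
    sumPts-cong zero    _  = refl
    sumPts-cong (suc m) eq = cong₂ _⊕_ (eq zero) (sumPts-cong m (eq ∘ suc))
    rowSum-x : ∀ ℓ → rowSum (lookup Rs ℓ) ≡ sumPts h (λ i → point A (x ℓ i))
    rowSum-x ℓ = trans (rowSum≡sumPts (lookup Rs ℓ)) (sumPts-cong h (λ i → cong (point A ∘ proj₁) (cell≡ ℓ i)))
    sums′ : SumsEqual Rs
    sums′ ℓ ℓ′ = trans (rowSum-x ℓ) (trans (sums ℓ ℓ′) (sym (rowSum-x ℓ′)))

  -- Every rainbow subtemplate comes from some ordered edge inside `C`, and an edge determines its
  -- template. Overcounting by reorderings only weakens the upper bound.
  count-rainbow : ∀ C Qs → RainbowSubtemplates k h {A = A} (toTemplate C) Qs → length Qs ≤ length (induced C edges)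
  count-rainbow C Qs (Qs! , all) = length≤-by-relation Codes injective (induced C edges) Qs! image
    where
    Codes : Template r A → Vec Vertex (k * h) → Set
    Codes Q e = ∃ λ Rs → e ≡ concat Rs × Represents Q Rs
    injective : ∀ {Q Q′ e} → Codes Q e → Codes Q′ e → Q ≡ Q′
    injective (Rs , refl , rep) (Rs′ , eq , rep′) with refl ← concat-injective Rs Rs′ eq = represents-unique Rs rep rep′
    image : ∀ {Q} → Q ∈ Qs → ∃ λ e → e ∈ induced C edges × Codes Q e
    image {Q} Q∈ with Q⊆ , rainbow ← All.lookup all Q∈ with Rs , sol , rep ← rainbow⇒represents Q rainbow =
      concat Rs , ∈-filter⁺ (contained? C) (∈-edges Rs sol) inside-C , Rs , refl , rep
      where
      in-Q : ∀ ℓ i → T (member Q (cell Rs ℓ i))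
      in-Q ℓ i = ∈ˢ⇒T (subst (proj₂ (cell Rs ℓ i) ∈ˢ_) (sym (proj₁ rep ℓ i)) (x∈⁅x⁆ _))
      in-C : ∀ ℓ i → T (C (cell Rs ℓ i))
      in-C ℓ i = subst T (member-toTemplate C _) (subtemplate Q (toTemplate C) Q⊆ (cell Rs ℓ i) (in-Q ℓ i))
      inside-C : VecAll.All (T ∘ C) (concat Rs)
      inside-C = concat⁺ {xss = Rs} (lookup⁻ (λ ℓ → lookup⁻ (in-C ℓ)))

-- Arithmetic

*-^ : ∀ m n k → (m * n) ^ k ≡ m ^ k * n ^ k
*-^ m n zero    = refl
*-^ m n (suc k) rewrite *-^ m n k = interchange m n (m ^ k) (n ^ k)
  where
  interchange : ∀ a b c d → a * b * (c * d) ≡ a * c * (b * d)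
  interchange = solve-∀

^-cancelˡ-≤ : ∀ k .{{_ : NonZero k}} {m n} → m ^ k ≤ n ^ k → m ≤ n
^-cancelˡ-≤ k {m} {n} le with m ≤? n
... | yes m≤n = m≤n
... | no  m≰n = contradiction le (<⇒≱ (^-monoˡ-< k (≰⇒> m≰n)))

2^-cancel-< : ∀ {m n} → 2 ^ m < 2 ^ n → m < n
2^-cancel-< {m} {n} lt with m <? n
... | yes m<n = m<n
... | no  m≮n = contradiction lt (≤⇒≯ (^-monoʳ-≤ 2 (≮⇒≥ m≮n)))

2^-cancel-≤ : ∀ {m n} → 2 ^ m ≤ 2 ^ n → m ≤ n
2^-cancel-≤ {m} {n} le with m ≤? n
... | yes m≤n = m≤n
... | no  m≰n = contradiction le (<⇒≱ (^-monoʳ-< 2 ≤-refl (≰⇒> m≰n)))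

n<2^n : ∀ n → n < 2 ^ n
n<2^n zero    = ≤-refl
n<2^n (suc n) = begin-strict
  suc n         ≤⟨ n<2^n n ⟩
  2 ^ n         <⟨ m<m+n (2 ^ n) (m^n>0 2 n) ⟩
  2 ^ n + 2 ^ n ≡⟨ cong (2 ^ n +_) (sym (+-identityʳ (2 ^ n))) ⟩
  2 ^ suc n     ∎
  where open ≤-Reasoning

transition : ∀ {P : ℕ → Set} → (∀ n → Dec (P n)) → P 0 → ∀ m → ¬ P m → ∃ λ b → P b × ¬ P (suc b)
transition P? p₀ zero    ¬p = contradiction p₀ ¬p
transition P? p₀ (suc m) ¬p with P? m
... | yes p = m , p , ¬p
... | no ¬q = transition P? p₀ m ¬q

floor-log₂ : ∀ n → 1 ≤ n → ∃ λ ℓ → 2 ^ ℓ ≤ n × n < 2 ^ suc ℓ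
floor-log₂ n 1≤n with ℓ , below , above ← transition (λ ℓ → 2 ^ ℓ ≤? n) 1≤n n (<⇒≱ (n<2^n n)) =
  ℓ , below , ≰⇒> above

-- The integer part of the e-th root of Y / X. The downward search may start at Y + 1, whose power
-- already exceeds Y.
floor-root : ∀ e .{{_ : NonZero e}} X .{{_ : NonZero X}} Y → ∃ λ b → b ^ e * X ≤ Y × Y < suc b ^ e * X
floor-root e@(suc e′) X Y =
  let b , below , above = transition (λ b → b ^ e * X ≤? Y) z≤n (suc Y) (<⇒≱ over) in b , below , ≰⇒> above
  where
  over : Y < suc Y ^ e * X
  over = ≤-trans (m≤m*n (suc Y) (suc Y ^ e′) {{m^n≢0 (suc Y) e′}}) (m≤m*n (suc Y ^ e) X)

-- The first two terms of the binomial expansion.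
bernoulli : ∀ x n → x ^ suc n + suc n * x ^ n ≤ suc x ^ suc n
bernoulli x zero    = ≤-reflexive (base x)
  where
  base : ∀ x → x * 1 + 1 ≡ 1 + x * 1
  base = solve-∀
bernoulli x (suc n) = begin
  x * (x * x ^ n) + suc (suc n) * (x * x ^ n)
    ≤⟨ m≤m+n _ (suc n * x ^ n) ⟩
  x * (x * x ^ n) + suc (suc n) * (x * x ^ n) + suc n * x ^ n
    ≡⟨ step x n (x ^ n) ⟩
  suc x * (x * x ^ n + suc n * x ^ n)
    ≤⟨ *-monoʳ-≤ (suc x) (bernoulli x n) ⟩
  suc x ^ suc (suc n) ∎
  where
  open ≤-Reasoning
  step : ∀ x n y → x * (x * y) + suc (suc n) * (x * y) + suc n * y ≡ suc x * (x * y + suc n * y)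
  step = solve-∀

-- In other words (1 - 1/D)^D ≤ 1/2: every `D` container steps halve the number of edges.
2*[D∸1]^D≤D^D : ∀ D .{{_ : NonZero D}} → 2 * (D ∸ 1) ^ D ≤ D ^ D
2*[D∸1]^D≤D^D (suc x) = begin
  2 * x ^ suc x                     ≡⟨ cong (x ^ suc x +_) (+-identityʳ (x ^ suc x)) ⟩
  x ^ suc x + x * x ^ x             ≤⟨ +-monoʳ-≤ (x ^ suc x) (*-monoˡ-≤ (x ^ x) (n≤1+n x)) ⟩
  x ^ suc x + suc x * x ^ x         ≤⟨ bernoulli x x ⟩
  suc x ^ suc x ∎
  where open ≤-Reasoning

decay-beats : ∀ D w e → 2 ≤ D → e < 2 ^ w → (D ∸ 1) ^ (D * w) * e < D ^ (D * w)
decay-beats D w e 2≤D e<2^w = begin-strict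
  (D ∸ 1) ^ (D * w) * e          <⟨ *-monoʳ-< ((D ∸ 1) ^ (D * w)) {{m^n≢0 (D ∸ 1) (D * w) {{>-nonZero (m<n⇒0<n∸m 2≤D)}}}} e<2^w ⟩
  (D ∸ 1) ^ (D * w) * 2 ^ w      ≡⟨ cong (_* 2 ^ w) (sym (^-*-assoc (D ∸ 1) D w)) ⟩
  ((D ∸ 1) ^ D) ^ w * 2 ^ w      ≡⟨ *-comm _ (2 ^ w) ⟩
  2 ^ w * ((D ∸ 1) ^ D) ^ w      ≡⟨ sym (*-^ 2 ((D ∸ 1) ^ D) w) ⟩
  (2 * (D ∸ 1) ^ D) ^ w          ≤⟨ ^-monoˡ-≤ w (2*[D∸1]^D≤D^D D {{>-nonZero (≤-trans (s≤s z≤n) 2≤D)}}) ⟩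
  (D ^ D) ^ w                    ≡⟨ ^-*-assoc D D w ⟩
  D ^ (D * w) ∎
  where open ≤-Reasoning

-- With q = ⌊ℓ/(m+1)⌋, 2^ℓ ≥ (2^q)^(m+1) ≥ (q+1)^(m+1) > (ℓ/(m+1))^(m+1).
poly≤exp : ∀ C m ℓ → C * suc m ^ suc m ≤ ℓ → C * ℓ ^ m ≤ 2 ^ ℓ
poly≤exp C m ℓ large = *-cancelˡ-≤ (suc m ^ suc m) {{m^n≢0 (suc m) (suc m)}} (begin
  suc m ^ suc m * (C * ℓ ^ m)   ≡⟨ regroup (suc m ^ suc m) C (ℓ ^ m) ⟩
  C * suc m ^ suc m * ℓ ^ m     ≤⟨ *-monoˡ-≤ (ℓ ^ m) large ⟩
  ℓ ^ suc m                     ≤⟨ ^-monoˡ-≤ (suc m) ℓ≤ ⟩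
  (suc m * suc q) ^ suc m       ≡⟨ *-^ (suc m) (suc q) (suc m) ⟩
  suc m ^ suc m * suc q ^ suc m ≤⟨ *-monoʳ-≤ (suc m ^ suc m) (^-monoˡ-≤ (suc m) (n<2^n q)) ⟩
  suc m ^ suc m * (2 ^ q) ^ suc m ≡⟨ cong (suc m ^ suc m *_) (^-*-assoc 2 q (suc m)) ⟩
  suc m ^ suc m * 2 ^ (q * suc m) ≤⟨ *-monoʳ-≤ (suc m ^ suc m) (^-monoʳ-≤ 2 (m/n*n≤m ℓ (suc m))) ⟩
  suc m ^ suc m * 2 ^ ℓ ∎)
  where
  open ≤-Reasoning
  q : ℕ
  q = ℓ / suc m
  regroup : ∀ x c y → x * (c * y) ≡ c * x * y
  regroup = solve-∀
  ℓ≤ : ℓ ≤ suc m * suc q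
  ℓ≤ = begin
    ℓ                         ≡⟨ m≡m%n+[m/n]*n ℓ (suc m) ⟩
    ℓ % suc m + q * suc m     ≤⟨ +-monoˡ-≤ (q * suc m) (<⇒≤ (m%n<n ℓ (suc m))) ⟩
    suc m + q * suc m         ≡⟨ *-comm (suc q) (suc m) ⟩
    suc m * suc q ∎

-- Here m = μ + α + 1 vertices of a solution are fixed and α + 1 is the number of full rows (or 1).
exponent-gap : ∀ k₁ h₁ t α μ → 1 ≤ k₁ → 1 ≤ h₁ → t ≡ suc k₁ * h₁ → 1 ≤ μ →
  α ≡ 0 ⊎ suc α * suc h₁ ≤ μ + suc α → μ + suc α < suc k₁ * suc h₁ → suc (t * (μ + α)) ≤ μ * (t + k₁)
exponent-gap k₁ h₁ t α μ 1≤k₁ 1≤h₁ t≡ 1≤μ cases m<s = begin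
  suc (t * (μ + α))     ≡⟨ r₁ t μ α ⟩
  μ * t + suc (t * α)   ≤⟨ +-monoʳ-≤ (μ * t) (gap cases) ⟩
  μ * t + μ * k₁        ≡⟨ sym (*-distribˡ-+ μ t k₁) ⟩
  μ * (t + k₁) ∎
  where
  open ≤-Reasoning
  r₁ : ∀ t μ α → suc (t * (μ + α)) ≡ μ * t + suc (t * α)
  r₁ = solve-∀
  gap : α ≡ 0 ⊎ suc α * suc h₁ ≤ μ + suc α → suc (t * α) ≤ μ * k₁
  gap (inj₁ refl) = ≤-trans (≤-reflexive (cong suc (*-zeroʳ t))) (*-mono-≤ 1≤μ 1≤k₁)
  gap (inj₂ full) = begin
    suc (t * α)                        ≡⟨ cong (λ x → suc (x * α)) t≡ ⟩
    suc (suc k₁ * h₁ * α)              ≡⟨ r₂ k₁ h₁ α ⟩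
    h₁ * k₁ * α + suc (h₁ * α)         ≤⟨ +-monoʳ-≤ (h₁ * k₁ * α) (+-monoˡ-≤ (h₁ * α) 1≤h₁) ⟩
    h₁ * k₁ * α + (h₁ + h₁ * α)        ≡⟨ cong (h₁ * k₁ * α +_) (sym (*-suc h₁ α)) ⟩
    h₁ * k₁ * α + h₁ * suc α           ≤⟨ +-monoʳ-≤ (h₁ * k₁ * α) (*-monoʳ-≤ h₁ α<k₁) ⟩
    h₁ * k₁ * α + h₁ * k₁              ≡⟨ r₃ h₁ k₁ α ⟩
    suc α * h₁ * k₁                    ≤⟨ *-monoˡ-≤ k₁ αh≤μ ⟩
    μ * k₁ ∎
    where
    r₂ : ∀ k h α → suc (suc k * h * α) ≡ h * k * α + suc (h * α)
    r₂ = solve-∀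
    r₃ : ∀ h k α → h * k * α + h * k ≡ suc α * h * k
    r₃ = solve-∀
    αh≤μ : suc α * h₁ ≤ μ
    αh≤μ = +-cancelʳ-≤ (suc α) _ _ (≤-trans (≤-reflexive (trans (+-comm _ (suc α)) (sym (*-suc (suc α) h₁)))) full)
    α<k₁ : suc α ≤ k₁
    α<k₁ = s≤s⁻¹ (*-cancelʳ-< (suc h₁) (suc α) (suc k₁) (≤-<-trans full m<s))

-- Compared after raising to the power `j`. The strict inequality between the exponents leaves one
-- spare factor `a`, which pays for X ^ j.
power-bound : ∀ {a b X t p μ} j .{{_ : NonZero j}} → b ^ j * X ≤ a ^ t → X ^ j ≤ a → 1 ≤ X → 1 ≤ a →
              suc (t * p) ≤ μ * j → b ^ p * X ≤ a ^ μ
power-bound {a} {b} {X} {t} {p} {μ} j b^jX≤ X^j≤a 1≤X 1≤a gap = ^-cancelˡ-≤ j (begin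
  (b ^ p * X) ^ j       ≡⟨ *-^ (b ^ p) X j ⟩
  (b ^ p) ^ j * X ^ j   ≡⟨ cong (_* X ^ j) swap ⟩
  (b ^ j) ^ p * X ^ j   ≤⟨ *-mono-≤ (^-monoˡ-≤ p (≤-trans (m≤m*n (b ^ j) X {{>-nonZero 1≤X}}) b^jX≤)) X^j≤a ⟩
  (a ^ t) ^ p * a       ≡⟨ trans (cong (_* a) (^-*-assoc a t p)) (*-comm (a ^ (t * p)) a) ⟩
  a ^ suc (t * p)       ≤⟨ ^-monoʳ-≤ a {{>-nonZero 1≤a}} gap ⟩
  a ^ (μ * j)           ≡⟨ sym (^-*-assoc a μ j) ⟩
  (a ^ μ) ^ j ∎)
  where
  open ≤-Reasoning
  swap : (b ^ p) ^ j ≡ (b ^ j) ^ p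
  swap = trans (^-*-assoc b p j) (trans (cong (b ^_) (*-comm p j)) (sym (^-*-assoc b j p)))

log-bound : ∀ n Λ p q → n ≤ 2 ^ Λ → 2 ^ p < n ^ q → p < Λ * q
log-bound n Λ p q n≤ lt = 2^-cancel-< (<-≤-trans lt (≤-trans (^-monoˡ-≤ q n≤) (≤-reflexive (^-*-assoc 2 Λ q))))

-- log n is a divisor on the right of (ii), so it is replaced by the upper bound `Λ`; in
-- `countBound` it is a factor on the right of (iii) and is replaced by the lower bound `ℓ`.
boundByLogPow : ∀ n Λ K M R → n ≤ 2 ^ Λ → R * Λ ^ K ≤ M → BoundByLogPow n K M R
boundByLogPow n Λ K M R n≤ le p q _ lt = begin
  R * p ^ K         ≤⟨ *-monoʳ-≤ R (^-monoˡ-≤ K (<⇒≤ (log-bound n Λ p q n≤ lt))) ⟩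
  R * (Λ * q) ^ K   ≡⟨ trans (cong (R *_) (*-^ Λ q K)) (sym (*-assoc R (Λ ^ K) (q ^ K))) ⟩
  R * Λ ^ K * q ^ K ≤⟨ *-monoˡ-≤ (q ^ K) le ⟩
  M * q ^ K ∎
  where open ≤-Reasoning

countBound : ∀ n ℓ a e b c M → 2 ^ ℓ ≤ n → c ≤ 2 ^ M → M ^ b * n ^ e ≤ a ^ b * ℓ ^ (10 * b) → CountBound n a e b c
countBound n ℓ a e b c M ℓ≤ c≤ le p q p′ q′ _ _ lt lt′ = begin
  p ^ b * n ^ e * q′ ^ (10 * b)
    ≤⟨ *-monoˡ-≤ (q′ ^ (10 * b)) (*-monoˡ-≤ (n ^ e) (^-monoˡ-≤ b (<⇒≤ (log-bound c M p q c≤ lt)))) ⟩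
  (M * q) ^ b * n ^ e * q′ ^ (10 * b)
    ≡⟨ cong (λ x → x * n ^ e * q′ ^ (10 * b)) (*-^ M q b) ⟩
  M ^ b * q ^ b * n ^ e * q′ ^ (10 * b)
    ≡⟨ r₁ (M ^ b) (q ^ b) (n ^ e) (q′ ^ (10 * b)) ⟩
  M ^ b * n ^ e * (q ^ b * q′ ^ (10 * b))
    ≤⟨ *-monoˡ-≤ _ le ⟩
  a ^ b * ℓ ^ (10 * b) * (q ^ b * q′ ^ (10 * b))
    ≡⟨ r₂ (a ^ b) (ℓ ^ (10 * b)) (q ^ b) (q′ ^ (10 * b)) ⟩
  a ^ b * q ^ b * (ℓ ^ (10 * b) * q′ ^ (10 * b))
    ≡⟨ cong (a ^ b * q ^ b *_) (sym (*-^ ℓ q′ (10 * b))) ⟩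
  a ^ b * q ^ b * (ℓ * q′) ^ (10 * b)
    ≤⟨ *-monoʳ-≤ (a ^ b * q ^ b) (^-monoˡ-≤ (10 * b) ℓq′≤p′) ⟩
  a ^ b * q ^ b * p′ ^ (10 * b) ∎
  where
  open ≤-Reasoning
  r₁ : ∀ x y z w → x * y * z * w ≡ x * z * (y * w)
  r₁ = solve-∀
  r₂ : ∀ x y z w → x * y * (z * w) ≡ x * z * (y * w)
  r₂ = solve-∀
  ℓq′≤p′ : ℓ * q′ ≤ p′
  ℓq′≤p′ = 2^-cancel-≤ (≤-trans (≤-reflexive (sym (^-*-assoc 2 ℓ q′))) (≤-trans (^-monoˡ-≤ q′ ℓ≤) (<⇒≤ lt′)))

-- Each container step keeps at most a proportion 1 − 1/D of the edges.
module Parameters (k₁ h₁ d r D : ℕ) (1≤k₁ : 1 ≤ k₁) (1≤h₁ : 1 ≤ h₁) (1≤d : 1 ≤ d) (1≤r : 1 ≤ r) (2≤D : 2 ≤ D) where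

  k h t j s : ℕ
  k = suc k₁
  h = suc h₁
  t = k * h₁
  j = h₁ + k₁ * h
  s = k * h

  j≡t+k₁ : j ≡ t + k₁
  j≡t+k₁ = identity k₁ h₁
    where
    identity : ∀ k h → h + k * suc h ≡ suc k * h + k
    identity = solve-∀

  1≤t : 1 ≤ t
  1≤t = *-mono-≤ (s≤s (z≤n {k₁})) 1≤h₁

  t≤j : t ≤ j
  t≤j = ≤-trans (m≤m+n t k₁) (≤-reflexive (sym j≡t+k₁))

  3≤j : 3 ≤ j
  3≤j = +-mono-≤ 1≤h₁ (*-mono-≤ 1≤k₁ (s≤s 1≤h₁))

  j≢0 : NonZero j
  j≢0 = >-nonZero (≤-trans (s≤s z≤n) 3≤j)

  -- `c₁ Λ` and `c₂ Λ` bound the bit lengths of the numbers of vertices and edges, and `c₃ Λ² f` the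
  -- logarithm of the number of containers. `c₄` is the constant in the codegree condition. In the
  -- final estimate `c₅` is the constant and `q` the power of Λ: 2j from M, t from n^d ≤ Λ a, 5s
  -- from X. The polynomial C₂ Λ ^ m₂ has to stay below 2 ^ Λ.
  c₁ c₂ c₃ c₄ c₅ q m₂ C₂ threshold : ℕ
  c₁ = d + r
  c₂ = suc (c₁ * h * k)
  c₃ = c₁ * j * (D * c₂)
  c₄ = D * (r ^ k * r ^ s)
  c₅ = (10 * r * c₃) ^ j * c₄
  q  = 2 * j + t + 5 * s
  m₂ = suc (5 * s * j)
  C₂ = 2 * (4 ^ j * c₄ ^ j)
  threshold = suc (c₅ * 2 ^ q + C₂ * suc m₂ ^ suc m₂)

  1≤c₄ : 1 ≤ c₄
  1≤c₄ = *-mono-≤ (≤-trans (s≤s z≤n) 2≤D) (*-mono-≤ (m^n>0 r {{>-nonZero 1≤r}} k) (m^n>0 r {{>-nonZero 1≤r}} s))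

  q<10j : suc q ≤ 10 * j
  q<10j = begin
    suc (2 * j + t + 5 * suc j)   ≡⟨ e₁ j t ⟩
    7 * j + t + 6                 ≤⟨ +-monoʳ-≤ (7 * j + t) (*-monoʳ-≤ 2 3≤j) ⟩
    7 * j + t + 2 * j             ≤⟨ +-monoˡ-≤ (2 * j) (+-monoʳ-≤ (7 * j) t≤j) ⟩
    7 * j + j + 2 * j             ≡⟨ e₂ j ⟩
    10 * j ∎
    where
    open ≤-Reasoning
    e₁ : ∀ j t → suc (2 * j + t + 5 * suc j) ≡ 7 * j + t + 6
    e₁ = solve-∀
    e₂ : ∀ j → 7 * j + j + 2 * j ≡ 10 * j
    e₂ = solve-∀

  module AtScale (n ℓ a N : ℕ) (N≡ : N ≡ a * r) (ℓ≤ : 2 ^ ℓ ≤ n) (<Λ : n < 2 ^ suc ℓ) (big : threshold ≤ ℓ)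
                 (large : 2 ^ (n ^ d) ≤ n ^ a) (a≤n^d : a ≤ n ^ d) where

    -- `X` gathers all that the codegree condition must beat besides powers of `a` and `b`. `W` and
    -- `w` bound the bit lengths of the numbers of vertices and edges.
    Λ X W w steps : ℕ
    Λ = suc ℓ
    X = c₄ * Λ ^ (5 * s)
    W = Λ * c₁
    w = suc (W * h * k)
    steps = D * w

    n≤2^Λ : n ≤ 2 ^ Λ
    n≤2^Λ = <⇒≤ <Λ

    1≤n : 1 ≤ n
    1≤n = ≤-trans (m^n>0 2 ℓ) ℓ≤

    1≤ℓ : 1 ≤ ℓ
    1≤ℓ = ≤-trans (s≤s z≤n) big

    n^d≤Λa : n ^ d ≤ Λ * a
    n^d≤Λa = 2^-cancel-≤ (≤-trans large (≤-trans (^-monoˡ-≤ a n≤2^Λ) (≤-reflexive (^-*-assoc 2 Λ a))))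

    1≤X : 1 ≤ X
    1≤X = *-mono-≤ 1≤c₄ (m^n>0 Λ (5 * s))

    -- `X` is polynomial in Λ, whereas `a` is at least 2 ^ ℓ / Λ. The factor 4 is what makes `b` at
    -- least 4.
    [4X]^j≤a : (4 * X) ^ j ≤ a
    [4X]^j≤a = *-cancelˡ-≤ Λ (begin
      Λ * (4 * X) ^ j ≤⟨ *-cancelˡ-≤ 2 (begin
        2 * (Λ * (4 * X) ^ j)
          ≡⟨ cong (λ x → 2 * (Λ * x)) (trans (*-^ 4 X j) (cong (4 ^ j *_) (*-^ c₄ (Λ ^ (5 * s)) j))) ⟩
        2 * (Λ * (4 ^ j * (c₄ ^ j * (Λ ^ (5 * s)) ^ j)))
          ≡⟨ cong (λ x → 2 * (Λ * (4 ^ j * (c₄ ^ j * x)))) (^-*-assoc Λ (5 * s) j) ⟩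
        2 * (Λ * (4 ^ j * (c₄ ^ j * Λ ^ (5 * s * j))))
          ≡⟨ regroup Λ (4 ^ j) (c₄ ^ j) (Λ ^ (5 * s * j)) ⟩
        C₂ * Λ ^ m₂
          ≤⟨ poly≤exp C₂ m₂ Λ (≤-trans (m≤n+m _ (c₅ * 2 ^ q)) (≤-trans (n≤1+n _) (≤-trans big (n≤1+n ℓ)))) ⟩
        2 * 2 ^ ℓ ∎) ⟩
      2 ^ ℓ   ≤⟨ ℓ≤ ⟩
      n       ≡⟨ sym (*-identityʳ n) ⟩
      n ^ 1   ≤⟨ ^-monoʳ-≤ n {{>-nonZero 1≤n}} 1≤d ⟩
      n ^ d   ≤⟨ n^d≤Λa ⟩
      Λ * a ∎)
      where
      open ≤-Reasoning
      regroup : ∀ x y z w → 2 * (x * (y * (z * w))) ≡ 2 * (y * z) * (x * w)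
      regroup = solve-∀

    1≤a : 1 ≤ a
    1≤a = ≤-trans (m^n>0 (4 * X) {{m*n≢0 4 X {{_}} {{>-nonZero 1≤X}}}} j) [4X]^j≤a

    a≢0 : NonZero a
    a≢0 = >-nonZero 1≤a

    X^j≤a : X ^ j ≤ a
    X^j≤a = ≤-trans (^-monoˡ-≤ j (m≤n*m X 4)) [4X]^j≤a

    abstract
      root : ∃ λ b → b ^ j * X ≤ a ^ t × a ^ t < suc b ^ j * X
      root = floor-root j {{j≢0}} X {{>-nonZero 1≤X}} (a ^ t)

    -- The integer part of (a^t / X)^(1/j). This is the largest value that the patterns fixing all
    -- `s` vertices permit.
    b : ℕ
    b = proj₁ root

    b^jX≤a^t : b ^ j * X ≤ a ^ t
    b^jX≤a^t = proj₁ (proj₂ root)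

    4≤b : 4 ≤ b
    4≤b with 4 ≤? b
    ... | yes le = le
    ... | no  gt = contradiction (proj₂ (proj₂ root)) (≤⇒≯ (begin
      suc b ^ j * X   ≤⟨ *-monoˡ-≤ X (^-monoˡ-≤ j (≰⇒> gt)) ⟩
      4 ^ j * X       ≤⟨ *-monoʳ-≤ (4 ^ j) (≤-trans (≤-reflexive (sym (*-identityʳ X)))
                           (^-monoʳ-≤ X {{>-nonZero 1≤X}} (≤-trans (s≤s z≤n) 3≤j))) ⟩
      4 ^ j * X ^ j   ≡⟨ sym (*-^ 4 X j) ⟩
      (4 * X) ^ j     ≤⟨ [4X]^j≤a ⟩
      a               ≡⟨ sym (*-identityʳ a) ⟩
      a ^ 1           ≤⟨ ^-monoʳ-≤ a {{a≢0}} 1≤t ⟩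
      a ^ t ∎))
      where open ≤-Reasoning

    b≢0 : NonZero b
    b≢0 = >-nonZero (≤-trans (s≤s z≤n) 4≤b)

    b≤a : b ≤ a
    b≤a = ^-cancelˡ-≤ j {{j≢0}} (≤-trans (m≤m*n (b ^ j) X {{>-nonZero 1≤X}})
      (≤-trans b^jX≤a^t (^-monoʳ-≤ a {{a≢0}} t≤j)))

    -- 4N / b rounded down, plus one; `b ≤ a ≤ N` keeps the loss by rounding within 5N / b.
    f : ℕ
    f = suc (_/_ (4 * N) b {{b≢0}})

    fuel : 4 * N ≤ f * b
    fuel = begin
      4 * N ≡⟨ m≡m%n+[m/n]*n (4 * N) b {{b≢0}} ⟩
      _%_ (4 * N) b {{b≢0}} + _/_ (4 * N) b {{b≢0}} * b ≤⟨ +-monoˡ-≤ _ (<⇒≤ (m%n<n (4 * N) b {{b≢0}})) ⟩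
      f * b ∎
      where open ≤-Reasoning

    fb≤5N : f * b ≤ 5 * N
    fb≤5N = +-mono-≤ (≤-trans b≤a (≤-trans (m≤m*n a r {{>-nonZero 1≤r}}) (≤-reflexive (sym N≡)))) (m/n*n≤m (4 * N) b {{b≢0}})

    N<2^W : suc N ≤ 2 ^ W
    N<2^W = begin
      suc N                   ≡⟨ cong suc N≡ ⟩
      suc (a * r)             ≤⟨ s≤s (*-monoˡ-≤ r (≤-trans a≤n^d (^-monoˡ-≤ d n≤2^Λ))) ⟩
      suc ((2 ^ Λ) ^ d * r)   ≤⟨ +-monoˡ-≤ _ (m^n>0 (2 ^ Λ) {{m^n≢0 2 Λ}} d) ⟩
      (2 ^ Λ) ^ d + (2 ^ Λ) ^ d * r ≡⟨ sym (*-suc ((2 ^ Λ) ^ d) r) ⟩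
      (2 ^ Λ) ^ d * suc r     ≤⟨ *-monoʳ-≤ ((2 ^ Λ) ^ d) (n<2^n r) ⟩
      (2 ^ Λ) ^ d * 2 ^ r     ≤⟨ *-monoʳ-≤ ((2 ^ Λ) ^ d) (^-monoʳ-≤ 2 (m≤n*m r Λ)) ⟩
      (2 ^ Λ) ^ d * 2 ^ (Λ * r) ≡⟨ cong (_* 2 ^ (Λ * r)) (^-*-assoc 2 Λ d) ⟩
      2 ^ (Λ * d) * 2 ^ (Λ * r) ≡⟨ sym (^-distribˡ-+-* 2 (Λ * d) (Λ * r)) ⟩
      2 ^ (Λ * d + Λ * r)     ≡⟨ cong (2 ^_) (sym (*-distribˡ-+ Λ d r)) ⟩
      2 ^ W ∎
      where open ≤-Reasoning

    edges-few : ∀ e → e ≤ (N ^ h) ^ k → (D ∸ 1) ^ steps * e < D ^ steps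
    edges-few e e≤ = decay-beats D w e 2≤D (begin-strict
      e                   ≤⟨ e≤ ⟩
      (N ^ h) ^ k         ≤⟨ ^-monoˡ-≤ k (^-monoˡ-≤ h (≤-trans (n≤1+n N) N<2^W)) ⟩
      ((2 ^ W) ^ h) ^ k   ≡⟨ trans (cong (_^ k) (^-*-assoc 2 W h)) (^-*-assoc 2 (W * h) k) ⟩
      2 ^ (W * h * k)     <⟨ ^-monoʳ-< 2 ≤-refl (n<1+n (W * h * k)) ⟩
      2 ^ w ∎)
      where open ≤-Reasoning

    M : ℕ
    M = W * f * j * steps

    containers-few : ((suc N ^ f) ^ j) ^ steps ≤ 2 ^ M
    containers-few = begin
      ((suc N ^ f) ^ j) ^ steps       ≤⟨ ^-monoˡ-≤ steps (^-monoˡ-≤ j (^-monoˡ-≤ f N<2^W)) ⟩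
      (((2 ^ W) ^ f) ^ j) ^ steps     ≡⟨ cong (λ x → (x ^ j) ^ steps) (^-*-assoc 2 W f) ⟩
      ((2 ^ (W * f)) ^ j) ^ steps     ≡⟨ cong (_^ steps) (^-*-assoc 2 (W * f) j) ⟩
      (2 ^ (W * f * j)) ^ steps       ≡⟨ ^-*-assoc 2 (W * f * j) steps ⟩
      2 ^ M ∎
      where open ≤-Reasoning

    M≤ : M ≤ Λ * Λ * c₃ * f
    M≤ = begin
      Λ * c₁ * f * j * (D * suc (Λ * c₁ * h * k))
        ≤⟨ *-monoʳ-≤ (Λ * c₁ * f * j) (*-monoʳ-≤ D (+-monoˡ-≤ (Λ * c₁ * h * k) (s≤s (z≤n {ℓ})))) ⟩
      Λ * c₁ * f * j * (D * (Λ + Λ * c₁ * h * k))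
        ≡⟨ regroup Λ c₁ f j D h k ⟩
      Λ * Λ * (c₁ * j * (D * suc (c₁ * h * k))) * f ∎
      where
      open ≤-Reasoning
      regroup : ∀ Λ c f j D h k → Λ * c * f * j * (D * (Λ + Λ * c * h * k)) ≡ Λ * Λ * (c * j * (D * suc (c * h * k))) * f
      regroup = solve-∀

    -- Maximality of `b` bounds a^t by (b + 1)^j X, and b + 1 ≤ 2b turns f (b + 1) into at most 10N.
    f^j*a^t≤ : f ^ j * a ^ t ≤ (10 * r) ^ j * a ^ j * X
    f^j*a^t≤ = begin
      f ^ j * a ^ t                 ≤⟨ *-monoʳ-≤ (f ^ j) (<⇒≤ (proj₂ (proj₂ root))) ⟩
      f ^ j * (suc b ^ j * X)       ≤⟨ *-monoʳ-≤ (f ^ j) (*-monoˡ-≤ X (^-monoˡ-≤ j suc-b≤)) ⟩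
      f ^ j * ((2 * b) ^ j * X)     ≡⟨ trans (sym (*-assoc (f ^ j) _ X)) (cong (_* X) (sym (*-^ f (2 * b) j))) ⟩
      (f * (2 * b)) ^ j * X         ≤⟨ *-monoˡ-≤ X (^-monoˡ-≤ j f2b≤) ⟩
      (10 * r * a) ^ j * X          ≡⟨ cong (_* X) (*-^ (10 * r) a j) ⟩
      (10 * r) ^ j * a ^ j * X ∎
      where
      open ≤-Reasoning
      e₁ : ∀ f b → f * (2 * b) ≡ 2 * (f * b)
      e₁ = solve-∀
      e₂ : ∀ a r → 2 * (5 * (a * r)) ≡ 10 * r * a
      e₂ = solve-∀
      suc-b≤ : suc b ≤ 2 * b
      suc-b≤ = +-mono-≤ (≤-trans (s≤s z≤n) 4≤b) (≤-reflexive (sym (+-identityʳ b)))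
      f2b≤ : f * (2 * b) ≤ 10 * r * a
      f2b≤ = ≤-trans (≤-reflexive (e₁ f b)) (≤-trans (*-monoʳ-≤ 2 fb≤5N) (≤-reflexive (trans (cong (λ y → 2 * (5 * y)) N≡) (e₂ a r))))

    constants-absorbed : c₅ * Λ ^ q ≤ ℓ ^ (10 * j)
    constants-absorbed = begin
      c₅ * Λ ^ q              ≤⟨ *-monoʳ-≤ c₅ (^-monoˡ-≤ q (+-mono-≤ 1≤ℓ (≤-reflexive (sym (+-identityʳ ℓ))))) ⟩
      c₅ * (2 * ℓ) ^ q        ≡⟨ trans (cong (c₅ *_) (*-^ 2 ℓ q)) (sym (*-assoc c₅ (2 ^ q) (ℓ ^ q))) ⟩
      c₅ * 2 ^ q * ℓ ^ q      ≤⟨ *-monoˡ-≤ (ℓ ^ q) (≤-trans (m≤m+n (c₅ * 2 ^ q) (C₂ * suc m₂ ^ suc m₂)) (≤-trans (n≤1+n _) big)) ⟩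
      ℓ ^ suc q               ≤⟨ ^-monoʳ-≤ ℓ {{>-nonZero 1≤ℓ}} q<10j ⟩
      ℓ ^ (10 * j) ∎
      where open ≤-Reasoning

    exponent-bound : M ^ j * n ^ (d * t) ≤ a ^ j * ℓ ^ (10 * j)
    exponent-bound = begin
      M ^ j * n ^ (d * t)
        ≤⟨ *-mono-≤ (^-monoˡ-≤ j M≤) (≤-trans (≤-reflexive (sym (^-*-assoc n d t))) (^-monoˡ-≤ t n^d≤Λa)) ⟩
      (Λ * Λ * c₃ * f) ^ j * (Λ * a) ^ t
        ≡⟨ cong₂ _*_ powers (*-^ Λ a t) ⟩
      Λ ^ j * Λ ^ j * c₃ ^ j * f ^ j * (Λ ^ t * a ^ t)
        ≡⟨ r₁ (Λ ^ j) (c₃ ^ j) (f ^ j) (Λ ^ t) (a ^ t) ⟩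
      Λ ^ j * Λ ^ j * c₃ ^ j * Λ ^ t * (f ^ j * a ^ t)
        ≤⟨ *-monoʳ-≤ (Λ ^ j * Λ ^ j * c₃ ^ j * Λ ^ t) f^j*a^t≤ ⟩
      Λ ^ j * Λ ^ j * c₃ ^ j * Λ ^ t * ((10 * r) ^ j * a ^ j * (c₄ * Λ ^ (5 * s)))
        ≡⟨ r₂ (Λ ^ j) (c₃ ^ j) (Λ ^ t) ((10 * r) ^ j) (a ^ j) c₄ (Λ ^ (5 * s)) ⟩
      a ^ j * ((10 * r) ^ j * c₃ ^ j * c₄ * (Λ ^ j * Λ ^ j * Λ ^ t * Λ ^ (5 * s)))
        ≡⟨ cong₂ (λ x y → a ^ j * (x * c₄ * y)) (sym (*-^ (10 * r) c₃ j)) collect ⟩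
      a ^ j * (c₅ * Λ ^ q)
        ≤⟨ *-monoʳ-≤ (a ^ j) constants-absorbed ⟩
      a ^ j * ℓ ^ (10 * j) ∎
      where
      open ≤-Reasoning
      r₁ : ∀ x c f y a → x * x * c * f * (y * a) ≡ x * x * c * y * (f * a)
      r₁ = solve-∀
      r₂ : ∀ x c y r a c₄ z → x * x * c * y * (r * a * (c₄ * z)) ≡ a * (r * c * c₄ * (x * x * y * z))
      r₂ = solve-∀
      powers : (Λ * Λ * c₃ * f) ^ j ≡ Λ ^ j * Λ ^ j * c₃ ^ j * f ^ j
      powers = trans (*-^ (Λ * Λ * c₃) f j) (cong (_* f ^ j)
        (trans (*-^ (Λ * Λ) c₃ j) (cong (_* c₃ ^ j) (*-^ Λ Λ j))))
      collect : Λ ^ j * Λ ^ j * Λ ^ t * Λ ^ (5 * s) ≡ Λ ^ q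
      collect = trans (cong (λ x → x * Λ ^ t * Λ ^ (5 * s)) (sym (^-distribˡ-+-* Λ j j)))
        (trans (cong (_* Λ ^ (5 * s)) (sym (^-distribˡ-+-* Λ (j + j) t)))
        (trans (sym (^-distribˡ-+-* Λ (j + j + t) (5 * s)))
               (cong (λ x → Λ ^ (j + x + t + 5 * s)) (sym (+-identityʳ j)))))

    module PartialSolution (m x α c e : ℕ) (2≤m : 2 ≤ m) (m≤s : m ≤ s) (c≤ : c ≤ r ^ k * N ^ x)
             (balance : x + k + m ≡ s + suc α) (rows : α ≡ 0 ⊎ suc α * h ≤ m)
             (dense : a ^ (t + 1) < e * Λ ^ (5 * s)) where

      private
        -- The target for the number of edges has the power t + 1 of `a`. The count of extensions
        -- together with the factor N uses x + 1 of them, and μ = t - x is what remains for b^(m-1)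
        -- X.
        μ : ℕ
        μ = m ∸ suc α

        α<m : α ≡ 0 ⊎ suc α * h ≤ m → suc α ≤ m
        α<m (inj₁ α≡0)  = ≤-trans (s≤s (≤-reflexive α≡0)) (≤-trans (s≤s z≤n) 2≤m)
        α<m (inj₂ full) = ≤-trans (m≤m*n (suc α) h) full

        m≡ : m ≡ μ + suc α
        m≡ = sym (m∸n+n≡m (α<m rows))

        x+μ≡t : x + μ ≡ t
        x+μ≡t = +-cancelʳ-≡ (suc α) _ _ (+-cancelʳ-≡ k _ _ (begin
          x + μ + suc α + k     ≡⟨ e₁ x μ (suc α) k ⟩
          x + k + (μ + suc α)   ≡⟨ cong (x + k +_) (sym m≡) ⟩
          x + k + m             ≡⟨ balance ⟩
          s + suc α             ≡⟨ e₂ k₁ h₁ (suc α) ⟩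
          t + suc α + k ∎))
          where
          open ≡-Reasoning
          e₁ : ∀ x μ α k → x + μ + α + k ≡ x + k + (μ + α)
          e₁ = solve-∀
          e₂ : ∀ k h α → suc k * suc h + α ≡ suc k * h + α + suc k
          e₂ = solve-∀

        m∸1≡ : m ∸ 1 ≡ μ + α
        m∸1≡ = cong (_∸ 1) (trans m≡ (+-suc μ α))

        -- Short of a whole solution the exponents leave a strict gap, and X is absorbed by the
        -- spare power of `a`.
        partial : m < s → b ^ (m ∸ 1) * X ≤ a ^ μ
        partial m<s = power-bound {a} {b} {X} {t} {m ∸ 1} {μ} j {{j≢0}} b^jX≤a^t X^j≤a 1≤X 1≤a
          (subst (λ y → suc (t * y) ≤ μ * j) (sym m∸1≡) (subst (λ y → suc (t * (μ + α)) ≤ μ * y) (sym j≡t+k₁)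
            (exponent-gap k₁ h₁ t α μ 1≤k₁ 1≤h₁ refl (1≤μ rows) (rows′ rows) (subst (_< s) m≡ m<s))))
          where
          rows′ : α ≡ 0 ⊎ suc α * h ≤ m → α ≡ 0 ⊎ suc α * suc h₁ ≤ μ + suc α
          rows′ (inj₁ eq)   = inj₁ eq
          rows′ (inj₂ full) = inj₂ (≤-trans full (≤-reflexive m≡))
          1≤μ : α ≡ 0 ⊎ suc α * h ≤ m → 1 ≤ μ
          1≤μ (inj₁ α≡0)  = m<n⇒0<n∸m (≤-trans (s≤s (s≤s (≤-reflexive α≡0))) 2≤m)
          1≤μ (inj₂ full) = m<n⇒0<n∸m (≤-trans (≤-trans (≤-reflexive (cong suc (sym (*-identityʳ (suc α)))))
            (*-monoʳ-< (suc α) (s≤s 1≤h₁))) full)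

        -- All vertices fixed: then every row is, and x = 0.
        entire : m ≡ s → b ^ (m ∸ 1) * X ≤ a ^ μ
        entire m≡s = ≤-trans (≤-reflexive (cong (λ y → b ^ (y ∸ 1) * X) m≡s)) (≤-trans b^jX≤a^t (^-monoʳ-≤ a {{a≢0}} (≤-trans (≤-reflexive (sym x+μ≡t)) (≤-reflexive (cong (_+ μ) x≡0)))))
          where
          x+k≡ : x + k ≡ suc α
          x+k≡ = +-cancelʳ-≡ s _ _ (trans (cong (x + k +_) (sym m≡s)) (trans balance (+-comm s (suc α))))
          α<k : α ≡ 0 ⊎ suc α * h ≤ m → suc α ≤ k
          α<k (inj₁ α≡0)  = s≤s (≤-trans (≤-reflexive α≡0) z≤n)
          α<k (inj₂ full) = *-cancelʳ-≤ (suc α) k h (≤-trans full m≤s)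
          x≡0 : x ≡ 0
          x≡0 = n≤0⇒n≡0 (+-cancelʳ-≤ k x 0 (≤-trans (≤-reflexive x+k≡) (α<k rows)))

        main : b ^ (m ∸ 1) * X ≤ a ^ μ
        main with m <? s
        ... | yes m<s = partial m<s
        ... | no  m≮s = entire (≤-antisym m≤s (≮⇒≥ m≮s))

        x<s : suc x ≤ s
        x<s = s≤s (≤-trans (m≤m+n x μ) (≤-trans (≤-reflexive x+μ≡t) t≤j))

      bound : D * N * b ^ (m ∸ 1) * c ≤ e
      bound = *-cancelʳ-≤ _ _ (Λ ^ (5 * s)) {{m^n≢0 Λ (5 * s)}} (begin
        D * N * b ^ (m ∸ 1) * c * Λ ^ (5 * s)
          ≤⟨ *-monoˡ-≤ (Λ ^ (5 * s)) (*-monoʳ-≤ (D * N * b ^ (m ∸ 1)) c≤) ⟩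
        D * N * b ^ (m ∸ 1) * (r ^ k * N ^ x) * Λ ^ (5 * s)
          ≡⟨ e₁ D N (b ^ (m ∸ 1)) (r ^ k) (N ^ x) (Λ ^ (5 * s)) ⟩
        D * r ^ k * Λ ^ (5 * s) * b ^ (m ∸ 1) * N ^ suc x
          ≡⟨ cong (D * r ^ k * Λ ^ (5 * s) * b ^ (m ∸ 1) *_) (trans (cong (_^ suc x) N≡) (*-^ a r (suc x))) ⟩
        D * r ^ k * Λ ^ (5 * s) * b ^ (m ∸ 1) * (a ^ suc x * r ^ suc x)
          ≤⟨ *-monoʳ-≤ (D * r ^ k * Λ ^ (5 * s) * b ^ (m ∸ 1))
               (*-monoʳ-≤ (a ^ suc x) (^-monoʳ-≤ r {{>-nonZero 1≤r}} x<s)) ⟩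
        D * r ^ k * Λ ^ (5 * s) * b ^ (m ∸ 1) * (a ^ suc x * r ^ s)
          ≡⟨ e₂ D (r ^ k) (Λ ^ (5 * s)) (b ^ (m ∸ 1)) (a ^ suc x) (r ^ s) ⟩
        b ^ (m ∸ 1) * X * a ^ suc x
          ≤⟨ *-monoˡ-≤ (a ^ suc x) main ⟩
        a ^ μ * a ^ suc x
          ≡⟨ sym (^-distribˡ-+-* a μ (suc x)) ⟩
        a ^ (μ + suc x)
          ≡⟨ cong (a ^_) (trans (e₃ μ x) (cong (_+ 1) x+μ≡t)) ⟩
        a ^ (t + 1)
          ≤⟨ <⇒≤ dense ⟩
        e * Λ ^ (5 * s) ∎)
        where
        open ≤-Reasoning
        e₁ : ∀ D N b r n l → D * N * b * (r * n) * l ≡ D * r * l * b * (N * n)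
        e₁ = solve-∀
        e₂ : ∀ D r l b a z → D * r * l * b * (a * z) ≡ b * (D * (r * z) * l) * a
        e₂ = solve-∀
        e₃ : ∀ μ x → μ + suc x ≡ x + μ + 1
        e₃ = solve-∀

    codegree-bound : ∀ m x a′ c e → 2 ≤ m → m ≤ s → c ≤ r ^ k * N ^ x → x + k + m ≡ s + a′ → 1 ≤ a′ →
      a′ ≡ 1 ⊎ a′ * h ≤ m → a ^ (t + 1) < e * Λ ^ (5 * s) → D * N * b ^ (m ∸ 1) * c ≤ e
    codegree-bound m x (suc α) c e 2≤m m≤s c≤ balance _ rows dense =
      PartialSolution.bound m x α c e 2≤m m≤s c≤ balance (map₁ suc-injective rows) dense

-- Assembly of the container theorem for templates

size≤n^d : ∀ {n d} (A : SubsetOfBox n d) → size A ≤ n ^ d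
size≤n^d {n} {d} A = ≤-trans
  (length≤-by-relation _≡_ (λ p q → trans p (sym q)) (vecs (applyUpTo suc n) d) (SubsetOfBox.unique A)
    (λ {x} x∈ → x , ∈-vecs (VecAll.map (λ { (s≤s _ , c≤n) → ∈-applyUpTo⁺ suc c≤n }) (All.lookup (inBox A) x∈)) , refl))
  (≤-reflexive (trans (length-vecs (applyUpTo suc n) d) (cong (_^ d) (length-applyUpTo suc n))))

module Assembly (d k₁ h₁ r : ℕ) (1≤d : 1 ≤ d) (1≤k₁ : 1 ≤ k₁) (1≤h₁ : 1 ≤ h₁) (1≤r : 1 ≤ r) where

  private
    D : ℕ
    D = decay (suc k₁ * suc h₁)

  open Parameters k₁ h₁ d r D 1≤k₁ 1≤h₁ 1≤d 1≤r (≤-trans (s≤s (s≤s z≤n)) (8≤decay (suc k₁ * suc h₁))) public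

  module _ (n ℓ : ℕ) (ℓ≤ : 2 ^ ℓ ≤ n) (<Λ : n < 2 ^ suc ℓ) (big : threshold ≤ ℓ)
           (A : SubsetOfBox n d) (large : LargeSet n d (size A)) where

    open Templates A k h r 1≤r

    open AtScale n ℓ (size A) (length vertices) length-vertices ℓ≤ <Λ big large (size≤n^d A)

    vertices≢[] : NonZero (length vertices)
    vertices≢[] = >-nonZero (≤-trans (*-mono-≤ 1≤a 1≤r) (≤-reflexive (sym length-vertices)))

    codegrees : ∀ u → 2 ≤ width u → ∀ e → size A ^ (t + 1) < e * Λ ^ (5 * s) →
      D * length vertices * b ^ (width u ∸ 1) * count (match? _≟_ u) edges ≤ e
    codegrees u 2≤u e dense =
      let x , a , count≤ , balance , 1≤a′ , rows = codegree-count solution? (λ Rs → proj₁) u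
      in codegree-bound (width u) x a _ e 2≤u (width≤length u) count≤ balance 1≤a′ rows dense

    open Iteration _≟_ vertices ∈-vertices j b f 4≤b fuel vertices≢[]
    open Iterate (Λ ^ (5 * s)) (size A ^ (t + 1)) (λ u → count (match? _≟_ u) edges) codegrees using (Outcome; iterate)

    edges≤ : length edges ≤ (length vertices ^ h) ^ k
    edges≤ = begin
      length edges                              ≡⟨ length-map _ (filter solution? (grids k h)) ⟩
      length (filter solution? (grids k h))     ≡⟨ length-filter solution? (grids k h) ⟩
      count solution? (grids k h)               ≤⟨ count≤length solution? (grids k h) ⟩
      length (grids k h)                        ≡⟨ length-vecs (vecs vertices h) k ⟩
      length (vecs vertices h) ^ k              ≡⟨ cong (_^ k) (length-vecs vertices h) ⟩
      (length vertices ^ h) ^ k ∎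
      where open ≤-Reasoning

    outcome : Outcome steps edges
    outcome = iterate steps edges (_ ≤? _) (λ _ _ → ≤-refl) (edges-few (length edges) edges≤)

    conclusion : Outcome steps edges → Σ (List (Template r A)) λ 𝒞 →
      (∀ (P : Template r A) → NoRainbow k h {A = A} P → Σ (Template r A) λ Q → Q ∈ 𝒞 × Subtemplate {A = A} P Q) ×
      (∀ (P : Template r A) → P ∈ 𝒞 → ∀ (Rs : List (Template r A)) → RainbowSubtemplates k h {A = A} P Rs →
        BoundByLogPow n (5 * s) (size A ^ (t + 1)) (length Rs)) ×
      CountBound n (size A) (d * t) j (length 𝒞)
    conclusion (𝒞 , count𝒞 , covers , sparse) = map toTemplate 𝒞 , contained , few , bound
      where
      contained : ∀ P → NoRainbow k h {A = A} P → Σ (Template r A) λ Q → Q ∈ map toTemplate 𝒞 × Subtemplate {A = A} P Q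
      contained P none = let C , C∈ , P⊑C = covers (member P) (noRainbow⇒independent P none) in
        toTemplate C , ∈-map⁺ toTemplate C∈ , ⊑⇒subtemplate P C P⊑C
      few′ : ∀ {P} → (∃ λ C → C ∈ 𝒞 × P ≡ toTemplate C) → ∀ Rs → RainbowSubtemplates k h {A = A} P Rs →
             BoundByLogPow n (5 * s) (size A ^ (t + 1)) (length Rs)
      few′ (C , C∈ , refl) Rs rainbow = boundByLogPow n Λ (5 * s) (size A ^ (t + 1)) (length Rs) n≤2^Λ
        (≤-trans (*-monoˡ-≤ (Λ ^ (5 * s)) (count-rainbow C Rs rainbow)) (sparse C∈))
      few : ∀ P → P ∈ map toTemplate 𝒞 → ∀ Rs → RainbowSubtemplates k h {A = A} P Rs →
            BoundByLogPow n (5 * s) (size A ^ (t + 1)) (length Rs)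
      few P P∈ = few′ (∈-map⁻ toTemplate P∈)
      bound : CountBound n (size A) (d * t) j (length (map toTemplate 𝒞))
      bound = countBound n ℓ (size A) (d * t) j _ M ℓ≤
        (≤-trans (≤-reflexive (length-map toTemplate 𝒞)) (≤-trans count𝒞 containers-few)) exponent-bound

theorem3p7 : (d k h r : ℕ) → 1 ≤ d → 2 ≤ k → 2 ≤ h → k * h ≤ r →
    ∃ λ (N : ℕ) → ∀ (n : ℕ) → N ≤ n →
    ∀ (A : SubsetOfBox n d) → LargeSet n d (size A) →
    Σ (List (Template r A)) λ 𝒞 →
    (∀ (T : Template r A) → NoRainbow k h {A = A} T →
    Σ (Template r A) λ P → P ∈ 𝒞 × Subtemplate {A = A} T P)
    × (∀ (P : Template r A) → P ∈ 𝒞 →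
    ∀ (Rs : List (Template r A)) → RainbowSubtemplates k h {A = A} P Rs →
    BoundByLogPow n (5 * (k * h)) (size A ^ (k * (h ∸ 1) + 1)) (length Rs))
    × CountBound n (size A) (d * (k * (h ∸ 1))) (k * h ∸ 1) (length 𝒞)
theorem3p7 d (suc k₁) (suc h₁) r 1≤d (s≤s 1≤k₁) (s≤s 1≤h₁) kh≤r = 2 ^ threshold , λ n N≤n A large →
  let ℓ , ℓ≤ , <Λ = floor-log₂ n (≤-trans (m^n>0 2 threshold) N≤n)
      -- From 2 ^ threshold ≤ n < 2 ^ (ℓ + 1) one gets threshold ≤ ℓ.
      big = s≤s⁻¹ (2^-cancel-< (≤-<-trans N≤n <Λ))
  in conclusion n ℓ ℓ≤ <Λ big A large (outcome n ℓ ℓ≤ <Λ big A large)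
  where
  1≤r : 1 ≤ r
  1≤r = ≤-trans (s≤s z≤n) kh≤r
  open Assembly d k₁ h₁ r 1≤d 1≤k₁ 1≤h₁ 1≤r using (threshold; outcome; conclusion)
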